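{- Let $q,z\in\mathbb{C}$ with $0<|q|<1$ and $0<|z|<1$. Then the sequences $$\alpha_n=\frac{z^{ -n}q^{\binom{n}{2}}(1-q^{2n+1})}{1-z}\quad(n\in\mathbb{Z}),\qquad \beta_n=\frac{(-z)_n(-1/z)_n}{(q)_{2n}}\quad(n\ge 0)$$ form an asymmetric bilateral Bailey pair with $a=1$ and $\lambda=1$; that is, for every integer $n\ge 0$, $$\beta_n=\sum_{k=-n-1}^{n}\frac{\alpha_k}{(q)_{n-k}(q)_{n+k+1}}.$$
   Context: For $n\ge 0$, $(a)_n=(a;q)_n=\prod_{j=1}^{n}(1-aq^{j-1})$, with $(a)_0=1$. For $m\in\mathbb{Z}$, $\binom{m}{2}=m(m-1)/2$. A pair of sequences $(\alpha_n)_{n\in\mathbb{Z}}$, $(\beta_n)_{n\ge 0}$ is an asymmetric bilateral Bailey pair with $a=1$, $\lambda=1$ if $\beta_n=\sum_{k=-n-1}^{n}\alpha_k/\big((q)_{n-k}(q)_{n+k+1}\big)$ for all $n\ge 0$. -}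

module Defs where

open import Level using (0ℓ)
open import Algebra.Bundles using (Semiring; CommutativeRing)
import Algebra.Definitions.RawSemiring as RawSemiringDefinitions
open import Data.Bool.Base using (T; true; false; if_then_else_)
open import Data.Empty using (⊥-elim)
open import Data.Fin.Base using (Fin; zero; suc; toℕ)
open import Data.Integer.Base as ℤ using (ℤ; +_; -[1+_])
import Data.Integer.DivMod as ℤ
import Data.Integer.Properties as ℤₚ
open import Data.Nat.Base as ℕ using (ℕ; zero; suc)
import Data.Nat.Properties as ℕₚ
open import Data.Product.Base using (Σ-syntax; _×_; _,_; proj₁; proj₂)
open import Data.Rational.Base as ℚ using (ℚ; 0ℚ; 1ℚ; ½; mkℚ) hiding (module ℚ)
import Data.Rational.Properties as ℚₚ
import Data.Rational.Solver as ℚSolver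
import Data.Rational.Unnormalised.Base as ℚᵘ
import Data.Rational.Unnormalised.Properties as ℚᵘₚ
open import Data.Sum.Base using (inj₁; inj₂)
open import Relation.Binary.PropositionalEquality
  using (_≡_; refl; sym; trans; cong; cong₂; subst; subst₂)
open import Relation.Nullary using (yes; no)

------------------------------------------------------------------------
-- Rational inequalities

module RationalLemmas where
  open ℚ using (_+_; _*_; -_; _-_; _<_; _≤_; ∣_∣)
  open ℚₚ
  open ℚSolver.+-*-Solver

  <-by : ∀ {a b x y} → a < b → b - a ≡ y - x → x < y
  <-by {a} {b} {x} {y} a<b e =
    subst₂ _<_ (l a x) (trans (cong (_+ x) e) (r x y)) (+-monoˡ-< x (+-monoˡ-< (- a) a<b))
    where
    l : ∀ a x → a - a + x ≡ x
    l = solve 2 (λ a x → a :- a :+ x := x) refl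
    r : ∀ x y → y - x + x ≡ y
    r = solve 2 (λ x y → y :- x :+ x := y) refl

  ≤-by : ∀ {a b x y} → a ≤ b → b - a ≡ y - x → x ≤ y
  ≤-by {a} {b} {x} {y} a≤b e =
    subst₂ _≤_ (l a x) (trans (cong (_+ x) e) (r x y)) (+-monoˡ-≤ x (+-monoˡ-≤ (- a) a≤b))
    where
    l : ∀ a x → a - a + x ≡ x
    l = solve 2 (λ a x → a :- a :+ x := x) refl
    r : ∀ x y → y - x + x ≡ y
    r = solve 2 (λ x y → y :- x :+ x := y) refl

  0<1 : 0ℚ < 1ℚ
  0<1 = positive⁻¹ 1ℚ

  *-pos : ∀ {a b} → 0ℚ < a → 0ℚ < b → 0ℚ < a * b
  *-pos {a} {b} 0<a 0<b =
    positive⁻¹ (a * b) {{pos*pos⇒pos a {{ℚ.positive 0<a}} b {{ℚ.positive 0<b}}}}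

  *-nonNeg : ∀ {a b} → 0ℚ ≤ a → 0ℚ ≤ b → 0ℚ ≤ a * b
  *-nonNeg {a} {b} 0≤a 0≤b = nonNegative⁻¹ (a * b)
    {{nonNeg*nonNeg⇒nonNeg a {{ℚ.nonNegative 0≤a}} b {{ℚ.nonNegative 0≤b}}}}

  +-nonNeg : ∀ {a b} → 0ℚ ≤ a → 0ℚ ≤ b → 0ℚ ≤ a + b
  +-nonNeg = +-mono-≤

  *-mono : ∀ {a b c d} → 0ℚ ≤ a → 0ℚ ≤ c → a ≤ b → c ≤ d → a * c ≤ b * d
  *-mono {a} {b} {c} {d} 0≤a 0≤c a≤b c≤d = ≤-trans
    (*-monoʳ-≤-nonNeg c {{ℚ.nonNegative 0≤c}} a≤b)
    (*-monoˡ-≤-nonNeg b {{ℚ.nonNegative (≤-trans 0≤a a≤b)}} c≤d)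

  sq-nonNeg : ∀ a → 0ℚ ≤ a * a
  sq-nonNeg a with ≤-total 0ℚ a
  ... | inj₁ 0≤a = *-nonNeg 0≤a 0≤a
  ... | inj₂ a≤0 = subst (0ℚ ≤_) (e a) (*-nonNeg 0≤-a 0≤-a)
    where
    e : ∀ a → - a * - a ≡ a * a
    e = solve 1 (λ a → :- a :* :- a := a :* a) refl
    0≤-a = neg-antimono-≤ a≤0

  sq-cancel-< : ∀ {a b} → 0ℚ ≤ b → a * a < b * b → a < b
  sq-cancel-< {a} {b} 0≤b aa<bb with a <? b
  ... | yes a<b = a<b
  ... | no a≮b = ⊥-elim (<-irrefl refl
    (<-≤-trans aa<bb (*-mono 0≤b 0≤b (≮⇒≥ a≮b) (≮⇒≥ a≮b))))

  half : ∀ {ε} → 0ℚ < ε → 0ℚ < ½ * ε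
  half = *-pos (positive⁻¹ ½)

  half+half : ∀ ε → ½ * ε + ½ * ε ≡ ε
  half+half = solve 1 (λ e → con ½ :* e :+ con ½ :* e := e) refl

  half≤ : ∀ {ε} → 0ℚ < ε → ½ * ε ≤ ε
  half≤ {ε} 0<ε = ≤-by (<⇒≤ (half 0<ε)) (e ε)
    where
    e : ∀ ε → ½ * ε - 0ℚ ≡ ε - ½ * ε
    e = solve 1 (λ e → con ½ :* e :- con 0ℚ := e :- con ½ :* e) refl

  p≤∣p∣ : ∀ p → p ≤ ∣ p ∣
  p≤∣p∣ p with ≤-total 0ℚ p
  ... | inj₁ 0≤p = ≤-reflexive (sym (0≤p⇒∣p∣≡p 0≤p))
  ... | inj₂ p≤0 = ≤-trans p≤0 (0≤∣p∣ p)

  ∣∣<-intro : ∀ {p ε} → p < ε → - p < ε → ∣ p ∣ < ε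
  ∣∣<-intro {p} p<ε -p<ε with ∣p∣≡p∨∣p∣≡-p p
  ... | inj₁ e = subst (_< _) (sym e) p<ε
  ... | inj₂ e = subst (_< _) (sym e) -p<ε

  ∣-∣-comm : ∀ a b → ∣ a - b ∣ ≡ ∣ b - a ∣
  ∣-∣-comm a b = trans (sym (∣-p∣≡∣p∣ (a - b))) (cong ∣_∣ (e a b))
    where
    e : ∀ a b → - (a - b) ≡ b - a
    e = solve 2 (λ a b → :- (a :- b) := b :- a) refl

  ∣x-x∣<ε : ∀ {x y ε} → x ≡ y → 0ℚ < ε → ∣ x - y ∣ < ε
  ∣x-x∣<ε {x} refl 0<ε = subst (λ u → ∣ u ∣ < _) (sym (+-inverseʳ x)) 0<ε

  sum-close : ∀ {u v} {ε} → ∣ u ∣ < ½ * ε → ∣ v ∣ < ½ * ε → ∣ u + v ∣ < ε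
  sum-close {u} {v} {ε} p q = ≤-<-trans (∣p+q∣≤∣p∣+∣q∣ u v)
    (subst (∣ u ∣ + ∣ v ∣ <_) (half+half ε) (+-mono-< p q))

  ∣∣-split : ∀ {w ε} u v → w ≡ u + v → ∣ u ∣ < ½ * ε → ∣ v ∣ < ½ * ε → ∣ w ∣ < ε
  ∣∣-split u v refl p q = sum-close {u} {v} p q

  scaled : ∀ {u b A η} → 0ℚ < A → ∣ u ∣ ≤ A → ∣ b ∣ < η → ∣ u * b ∣ < A * η
  scaled {u} {b} {A} {η} 0<A u≤A b<η = ≤-<-trans
    (≤-trans (≤-reflexive (∣p*q∣≡∣p∣*∣q∣ u b))
             (*-monoʳ-≤-nonNeg ∣ b ∣ {{∣-∣-nonNeg b}} u≤A))
    (*-monoʳ-<-pos A {{ℚ.positive 0<A}} b<η)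

  product-close : ∀ {a b a′ b′ A B η θ ε} → 0ℚ < A → 0ℚ < B →
    A * η ≡ ½ * ε → B * θ ≡ ½ * ε →
    ∣ a ∣ ≤ A → ∣ b′ ∣ ≤ B → ∣ b - b′ ∣ < η → ∣ a - a′ ∣ < θ → ∣ a * b - a′ * b′ ∣ < ε
  product-close {a} {b} {a′} {b′} 0<A 0<B e₁ e₂ a≤A b≤B b< a< =
    ∣∣-split (a * (b - b′)) (b′ * (a - a′)) (e a b a′ b′)
      (subst (_ <_) e₁ (scaled 0<A a≤A b<))
      (subst (_ <_) e₂ (scaled 0<B b≤B a<))
    where
    e : ∀ a b a′ b′ → a * b - a′ * b′ ≡ a * (b - b′) + b′ * (a - a′)
    e = solve 4 (λ a b a′ b′ →
      a :* b :- a′ :* b′ := a :* (b :- b′) :+ b′ :* (a :- a′)) refl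

  -- 1/p, with the value 0 at p = 0.
  recip : ℚ → ℚ
  recip p with p ≟ 0ℚ
  ... | yes _  = 0ℚ
  ... | no p≢0 = ℚ.1/_ p {{ℚ.≢-nonZero p≢0}}

  recip-inverse : ∀ {p} → 0ℚ < p → p * recip p ≡ 1ℚ
  recip-inverse {p} 0<p with p ≟ 0ℚ
  ... | yes refl = ⊥-elim (<-irrefl refl 0<p)
  ... | no p≢0   = *-inverseʳ p {{ℚ.≢-nonZero p≢0}}

  recip-pos : ∀ {p} → 0ℚ < p → 0ℚ < recip p
  recip-pos {p} 0<p with 0ℚ <? recip p
  ... | yes 0<r = 0<r
  ... | no 0≮r  = ⊥-elim (<-irrefl refl (<-≤-trans 0<1 1≤0))
    where
    1≤0 : 1ℚ ≤ 0ℚ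
    1≤0 = subst₂ _≤_ (recip-inverse 0<p) (*-zeroʳ p)
      (*-monoˡ-≤-nonNeg p {{ℚ.nonNegative (<⇒≤ 0<p)}} (≮⇒≥ 0≮r))

  recip-anti : ∀ {d p} → 0ℚ < d → d ≤ p → recip p ≤ recip d
  recip-anti {d} {p} 0<d d≤p = subst₂ _≤_ l r
    (*-monoʳ-≤-nonNeg (recip d * recip p)
      {{ℚ.nonNegative (*-nonNeg (<⇒≤ (recip-pos 0<d)) (<⇒≤ (recip-pos 0<p)))}} d≤p)
    where
    0<p = <-≤-trans 0<d d≤p
    l : d * (recip d * recip p) ≡ recip p
    l = trans (sym (*-assoc d (recip d) (recip p)))
        (trans (cong (_* recip p) (recip-inverse 0<d)) (*-identityˡ _))
    r : p * (recip d * recip p) ≡ recip d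
    r = trans (e p (recip d) (recip p))
        (trans (cong (_* recip d) (recip-inverse 0<p)) (*-identityˡ _))
      where
      e : ∀ p s r → p * (s * r) ≡ (p * r) * s
      e = solve 3 (λ p s r → p :* (s :* r) := (p :* r) :* s) refl

  shrink : ∀ {B ε} → 0ℚ < B → 0ℚ < ε → Σ[ η ∈ ℚ ] 0ℚ < η × B * η ≡ ε
  shrink {B} {ε} 0<B 0<ε = recip B * ε , *-pos (recip-pos 0<B) 0<ε ,
    trans (sym (*-assoc B (recip B) ε))
      (trans (cong (_* ε) (recip-inverse 0<B)) (*-identityˡ ε))

  recip-close : ∀ {d a b η ε} → 0ℚ < d → d ≤ a → d ≤ b →
    (recip d * recip d) * η ≡ ε → ∣ a - b ∣ < η → ∣ recip a - recip b ∣ < ε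
  recip-close {d} {a} {b} {η} {ε} 0<d d≤a d≤b e a-b<η =
    subst₂ (λ u v → ∣ u ∣ < v) eq e
      (scaled {recip a * recip b} {b - a}
        (*-pos (recip-pos 0<d) (recip-pos 0<d)) bound
        (subst (_< η) (∣-∣-comm a b) a-b<η))
    where
    0<a = <-≤-trans 0<d d≤a
    0<b = <-≤-trans 0<d d≤b
    0≤ra = <⇒≤ (recip-pos 0<a)
    0≤rb = <⇒≤ (recip-pos 0<b)
    bound : ∣ recip a * recip b ∣ ≤ recip d * recip d
    bound = subst (_≤ _) (sym (0≤p⇒∣p∣≡p (*-nonNeg 0≤ra 0≤rb)))
      (*-mono 0≤ra 0≤rb (recip-anti 0<d d≤a) (recip-anti 0<d d≤b))
    rearrange : ∀ a b r s → (r * s) * (b - a) ≡ r * (b * s) - s * (a * r)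
    rearrange = solve 4 (λ a b r s →
      (r :* s) :* (b :- a) := r :* (b :* s) :- s :* (a :* r)) refl
    eq : (recip a * recip b) * (b - a) ≡ recip a - recip b
    eq = trans (rearrange a b (recip a) (recip b))
      (cong₂ _-_ {recip a * (b * recip b)} {recip a} {recip b * (a * recip a)} {recip b}
        (trans (cong (recip a *_) (recip-inverse 0<b)) (*-identityʳ (recip a)))
        (trans (cong (recip b *_) (recip-inverse 0<a)) (*-identityʳ (recip b))))

open RationalLemmas

------------------------------------------------------------------------
-- Real numbers: Cauchy sequences of rationals

Eventually : (ℕ → Set) → Set
Eventually P = Σ[ N ∈ ℕ ] (∀ n → N ℕ.≤ n → P n)

Eventually₂ : (ℕ → ℕ → Set) → Set
Eventually₂ P = Σ[ N ∈ ℕ ] (∀ m n → N ℕ.≤ m → N ℕ.≤ n → P m n)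

IsCauchy : (ℕ → ℚ) → Set
IsCauchy s = ∀ ε → 0ℚ ℚ.< ε → Eventually₂ (λ m n → ℚ.∣ s m ℚ.- s n ∣ ℚ.< ε)

record ℝ : Set where
  constructor mkℝ
  field
    seq    : ℕ → ℚ
    cauchy : IsCauchy seq

open ℝ public

infix 4 _≈ᵣ_ _<ᵣ_

_≈ᵣ_ : ℝ → ℝ → Set
x ≈ᵣ y = ∀ ε → 0ℚ ℚ.< ε → Eventually (λ n → ℚ.∣ seq x n ℚ.- seq y n ∣ ℚ.< ε)

_<ᵣ_ : ℝ → ℝ → Set
x <ᵣ y = Σ[ ε ∈ ℚ ] 0ℚ ℚ.< ε × Eventually (λ n → seq x n ℚ.+ ε ℚ.≤ seq y n)

ev-map : ∀ {P Q : ℕ → Set} → (∀ n → P n → Q n) → Eventually P → Eventually Q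
ev-map f (N , p) = N , λ n N≤n → f n (p n N≤n)

ev-zip : ∀ {P Q R : ℕ → Set} → (∀ n → P n → Q n → R n) →
  Eventually P → Eventually Q → Eventually R
ev-zip f (M , p) (N , q) = M ℕ.⊔ N , λ n h →
  f n (p n (ℕₚ.m⊔n≤o⇒m≤o M N h)) (q n (ℕₚ.m⊔n≤o⇒n≤o M N h))

ev₂-zip : ∀ {P Q R : ℕ → ℕ → Set} → (∀ m n → P m n → Q m n → R m n) →
  Eventually₂ P → Eventually₂ Q → Eventually₂ R
ev₂-zip f (M , p) (N , q) = M ℕ.⊔ N , λ m n h k →
  f m n (p m n (ℕₚ.m⊔n≤o⇒m≤o M N h) (ℕₚ.m⊔n≤o⇒m≤o M N k))
        (q m n (ℕₚ.m⊔n≤o⇒n≤o M N h) (ℕₚ.m⊔n≤o⇒n≤o M N k))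

ev₂-both : ∀ {P Q : ℕ → Set} → Eventually P → Eventually Q → Eventually₂ (λ m n → P m × Q n)
ev₂-both (M , p) (N , q) = M ℕ.⊔ N , λ m n h k →
  p m (ℕₚ.m⊔n≤o⇒m≤o M N h) , q n (ℕₚ.m⊔n≤o⇒n≤o M N k)

≡⇒≈ᵣ : ∀ {x y} → Eventually (λ n → seq x n ≡ seq y n) → x ≈ᵣ y
≡⇒≈ᵣ h ε 0<ε = ev-map (λ _ e → ∣x-x∣<ε e 0<ε) h

pointwise : ∀ {x y} → (∀ n → seq x n ≡ seq y n) → x ≈ᵣ y
pointwise {x} {y} h = ≡⇒≈ᵣ {x} {y} (0 , λ n _ → h n)

≈ᵣ-refl : ∀ {x} → x ≈ᵣ x
≈ᵣ-refl {x} = pointwise {x} {x} (λ _ → refl)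

≈ᵣ-sym : ∀ {x y} → x ≈ᵣ y → y ≈ᵣ x
≈ᵣ-sym {x} {y} h ε 0<ε =
  ev-map (λ n → subst (ℚ._< ε) (∣-∣-comm (seq x n) (seq y n))) (h ε 0<ε)

≈ᵣ-trans : ∀ {x y z} → x ≈ᵣ y → y ≈ᵣ z → x ≈ᵣ z
≈ᵣ-trans {x} {y} {z} h k ε 0<ε = ev-zip
  (λ n → ∣∣-split (seq x n ℚ.- seq y n) (seq y n ℚ.- seq z n) (e (seq x n) (seq y n) (seq z n)))
  (h (½ ℚ.* ε) (half 0<ε)) (k (½ ℚ.* ε) (half 0<ε))
  where
  open ℚSolver.+-*-Solver
  e : ∀ a b c → a ℚ.- c ≡ (a ℚ.- b) ℚ.+ (b ℚ.- c)
  e = solve 3 (λ a b c → a :- c := (a :- b) :+ (b :- c)) refl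

bounded : ∀ x → Σ[ B ∈ ℚ ] 0ℚ ℚ.< B × Eventually (λ n → ℚ.∣ seq x n ∣ ℚ.≤ B)
bounded x with cauchy x 1ℚ 0<1
... | N , h = ℚ.∣ seq x N ∣ ℚ.+ 1ℚ
            , ℚₚ.+-mono-≤-< (ℚₚ.0≤∣p∣ (seq x N)) 0<1
            , N , λ n N≤n → ℚₚ.≤-trans
                (ℚₚ.≤-reflexive (cong ℚ.∣_∣ (e (seq x N) (seq x n))))
                (ℚₚ.≤-trans (ℚₚ.∣p+q∣≤∣p∣+∣q∣ (seq x N) (seq x n ℚ.- seq x N))
                  (ℚₚ.+-monoʳ-≤ ℚ.∣ seq x N ∣ (ℚₚ.<⇒≤ (h n N N≤n ℕₚ.≤-refl))))
  where
  open ℚSolver.+-*-Solver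
  e : ∀ a b → b ≡ a ℚ.+ (b ℚ.- a)
  e = solve 2 (λ a b → b := a :+ (b :- a)) refl

private
  sum-diff : ∀ a b c d → (a ℚ.+ b) ℚ.- (c ℚ.+ d) ≡ (a ℚ.- c) ℚ.+ (b ℚ.- d)
  sum-diff = solve 4 (λ a b c d → (a :+ b) :- (c :+ d) := (a :- c) :+ (b :- d)) refl
    where open ℚSolver.+-*-Solver

  neg-diff : ∀ a b → b ℚ.- a ≡ (ℚ.- a) ℚ.- (ℚ.- b)
  neg-diff = solve 2 (λ a b → b :- a := (:- a) :- (:- b)) refl
    where open ℚSolver.+-*-Solver

constᵣ : ℚ → ℝ
constᵣ p = mkℝ (λ _ → p) (λ ε 0<ε → 0 , λ _ _ _ _ → ∣x-x∣<ε {p} refl 0<ε)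

0ᵣ 1ᵣ : ℝ
0ᵣ = constᵣ 0ℚ
1ᵣ = constᵣ 1ℚ

infixl 6 _+ᵣ_ _-ᵣ_
infixl 7 _*ᵣ_
infix  8 -ᵣ_

_+ᵣ_ : ℝ → ℝ → ℝ
x +ᵣ y = mkℝ (λ n → seq x n ℚ.+ seq y n) c
  where
  c : IsCauchy (λ n → seq x n ℚ.+ seq y n)
  c ε 0<ε = ev₂-zip
    (λ m n → ∣∣-split _ _ (sum-diff (seq x m) (seq y m) (seq x n) (seq y n)))
    (cauchy x (½ ℚ.* ε) (half 0<ε)) (cauchy y (½ ℚ.* ε) (half 0<ε))

-ᵣ_ : ℝ → ℝ
-ᵣ x = mkℝ (λ n → ℚ.- seq x n) c
  where
  c : IsCauchy (λ n → ℚ.- seq x n)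
  c ε 0<ε with cauchy x ε 0<ε
  ... | N , h = N , λ m n p q →
    subst (λ u → ℚ.∣ u ∣ ℚ.< ε) (neg-diff (seq x m) (seq x n)) (h n m q p)

_-ᵣ_ : ℝ → ℝ → ℝ
x -ᵣ y = x +ᵣ (-ᵣ y)

_*ᵣ_ : ℝ → ℝ → ℝ
x *ᵣ y = mkℝ (λ n → seq x n ℚ.* seq y n) c
  where
  c : IsCauchy (λ n → seq x n ℚ.* seq y n)
  c ε 0<ε =
    let A , 0<A , a = bounded x
        B , 0<B , b = bounded y
        η , 0<η , e₁ = shrink 0<A (half 0<ε)
        θ , 0<θ , e₂ = shrink 0<B (half 0<ε)
    in ev₂-zip
      (λ m n ab hk → product-close {seq x m} {seq y m} {seq x n} {seq y n} {A} {B} {η} {θ} {ε}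
        0<A 0<B e₁ e₂ (proj₁ ab) (proj₂ ab) (proj₁ hk) (proj₂ hk))
      (ev₂-both a b) (ev₂-zip (λ _ _ → _,_) (cauchy y η 0<η) (cauchy x θ 0<θ))

+ᵣ-cong : ∀ {x x′ y y′} → x ≈ᵣ x′ → y ≈ᵣ y′ → x +ᵣ y ≈ᵣ x′ +ᵣ y′
+ᵣ-cong {x} {x′} {y} {y′} h k ε 0<ε = ev-zip
  (λ n → ∣∣-split _ _ (sum-diff (seq x n) (seq y n) (seq x′ n) (seq y′ n)))
  (h (½ ℚ.* ε) (half 0<ε)) (k (½ ℚ.* ε) (half 0<ε))

-ᵣ-cong : ∀ {x x′} → x ≈ᵣ x′ → -ᵣ x ≈ᵣ -ᵣ x′
-ᵣ-cong {x} {x′} h ε 0<ε = ev-map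
  (λ n p → subst (λ u → ℚ.∣ u ∣ ℚ.< ε) (neg-diff (seq x n) (seq x′ n))
             (subst (ℚ._< ε) (∣-∣-comm (seq x n) (seq x′ n)) p))
  (h ε 0<ε)

*ᵣ-cong : ∀ {x x′ y y′} → x ≈ᵣ x′ → y ≈ᵣ y′ → x *ᵣ y ≈ᵣ x′ *ᵣ y′
*ᵣ-cong {x} {x′} {y} {y′} h k ε 0<ε =
  let A , 0<A , a = bounded x
      B , 0<B , b = bounded y′
      η , 0<η , e₁ = shrink 0<A (half 0<ε)
      θ , 0<θ , e₂ = shrink 0<B (half 0<ε)
  in ev-zip
    (λ n ab kh → product-close {seq x n} {seq y n} {seq x′ n} {seq y′ n} {A} {B} {η} {θ} {ε}
      0<A 0<B e₁ e₂ (proj₁ ab) (proj₂ ab) (proj₁ kh) (proj₂ kh))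
    (ev-zip (λ _ → _,_) a b) (ev-zip (λ _ → _,_) (k η 0<η) (h θ 0<θ))

recipᵣ : (x : ℝ) → 0ᵣ <ᵣ x → ℝ
recipᵣ x (d , 0<d , K , d≤x) = mkℝ (λ n → recip (seq x n)) c
  where
  d≤ : ∀ n → K ℕ.≤ n → d ℚ.≤ seq x n
  d≤ n p = subst (ℚ._≤ seq x n) (ℚₚ.+-identityˡ d) (d≤x n p)
  c : IsCauchy (λ n → recip (seq x n))
  c ε 0<ε =
    let η , 0<η , e = shrink (*-pos (recip-pos 0<d) (recip-pos 0<d)) 0<ε
    in ev₂-zip
      (λ m n dd h → recip-close {d} {seq x m} {seq x n} {η} {ε} 0<d (proj₁ dd) (proj₂ dd) e h)
      (ev₂-both (K , d≤) (K , d≤)) (cauchy x η 0<η)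

------------------------------------------------------------------------
-- Square roots

-- Bisection for √p: starting from (0 , p + 1), each step halves the interval
-- (l , h) keeping l² ≤ p < h².
refine : ℚ → ℚ × ℚ → ℚ × ℚ
refine p (l , h) =
  let m = ½ ℚ.* (l ℚ.+ h)
  in if (m ℚ.* m) ℚ.≤ᵇ p then (m , h) else (l , m)

bisect : ℚ → ℕ → ℚ × ℚ
bisect p zero    = 0ℚ , p ℚ.+ 1ℚ
bisect p (suc n) = refine p (bisect p n)

module SqrtLemmas where
  open ℚ using (_+_; _*_; -_; _-_; _<_; _≤_; ∣_∣; _⊔_)
  open ℚₚ
  open ℚSolver.+-*-Solver

  record Bracket (p δ : ℚ) (lh : ℚ × ℚ) : Set where
    field
      lower≥0 : 0ℚ ≤ proj₁ lh
      lower²≤ : proj₁ lh * proj₁ lh ≤ p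
      upper²> : p < proj₂ lh * proj₂ lh
      width   : proj₂ lh ≡ proj₁ lh + δ

  half^ : ℕ → ℚ
  half^ zero    = 1ℚ
  half^ (suc n) = ½ * half^ n

  refine-bracket : ∀ {p δ} → 0ℚ ≤ δ → ∀ lh → Bracket p δ lh → Bracket p (½ * δ) (refine p lh)
  refine-bracket {p} {δ} 0≤δ (l , h) b
    with (½ * (l + h)) * (½ * (l + h)) ℚ.≤ᵇ p in eq
  ... | true = record
    { lower≥0 = *-nonNeg (nonNegative⁻¹ ½) (+-nonNeg 0≤l 0≤h)
    ; lower²≤ = ≤ᵇ⇒≤ (subst T (sym eq) _)
    ; upper²> = Bracket.upper²> b
    ; width   = trans w (trans (e l δ) (cong (λ h → ½ * (l + h) + ½ * δ) (sym w)))
    }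
    where
    w = Bracket.width b
    0≤l = Bracket.lower≥0 b
    0≤h = subst (0ℚ ≤_) (sym w) (+-nonNeg 0≤l 0≤δ)
    e : ∀ l δ → l + δ ≡ ½ * (l + (l + δ)) + ½ * δ
    e = solve 2 (λ l δ → l :+ δ := con ½ :* (l :+ (l :+ δ)) :+ con ½ :* δ) refl
  ... | false = record
    { lower≥0 = Bracket.lower≥0 b
    ; lower²≤ = Bracket.lower²≤ b
    ; upper²> = ≰⇒> (λ m²≤p → subst T eq (≤⇒≤ᵇ m²≤p))
    ; width   = trans (cong (λ h → ½ * (l + h)) (Bracket.width b)) (e l δ)
    }
    where
    e : ∀ l δ → ½ * (l + (l + δ)) ≡ l + ½ * δ
    e = solve 2 (λ l δ → con ½ :* (l :+ (l :+ δ)) := l :+ con ½ :* δ) refl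

  half^-nonNeg : ∀ n → 0ℚ ≤ half^ n
  half^-nonNeg zero    = <⇒≤ 0<1
  half^-nonNeg (suc n) = *-nonNeg (nonNegative⁻¹ ½) (half^-nonNeg n)

  bracket : ∀ {p} → 0ℚ ≤ p → ∀ n → Bracket p ((p + 1ℚ) * half^ n) (bisect p n)
  bracket {p} 0≤p zero = record
    { lower≥0 = ≤-refl
    ; lower²≤ = 0≤p
    ; upper²> = <-by (+-mono-≤-< (+-nonNeg (*-nonNeg 0≤p 0≤p) 0≤p) 0<1) (e p)
    ; width   = w p
    }
    where
    e : ∀ p → p * p + p + 1ℚ - (0ℚ + 0ℚ) ≡ (p + 1ℚ) * (p + 1ℚ) - p
    e = solve 1 (λ p → p :* p :+ p :+ con 1ℚ :- (con 0ℚ :+ con 0ℚ)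
                    := (p :+ con 1ℚ) :* (p :+ con 1ℚ) :- p) refl
    w : ∀ p → p + 1ℚ ≡ 0ℚ + (p + 1ℚ) * 1ℚ
    w = solve 1 (λ p → p :+ con 1ℚ := con 0ℚ :+ (p :+ con 1ℚ) :* con 1ℚ) refl
  bracket {p} 0≤p (suc n) =
    subst (λ δ → Bracket p δ (bisect p (suc n))) (e (p + 1ℚ) (half^ n))
      (refine-bracket (*-nonNeg (+-nonNeg 0≤p (<⇒≤ 0<1)) (half^-nonNeg n))
        (bisect p n) (bracket 0≤p n))
    where
    e : ∀ a b → ½ * (a * b) ≡ a * (½ * b)
    e = solve 2 (λ a b → con ½ :* (a :* b) := a :* (con ½ :* b)) refl

  fromℕ : ℕ → ℚ
  fromℕ zero    = 0ℚ
  fromℕ (suc n) = 1ℚ + fromℕ n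

  fromℕ-nonNeg : ∀ n → 0ℚ ≤ fromℕ n
  fromℕ-nonNeg zero    = ≤-refl
  fromℕ-nonNeg (suc n) = +-nonNeg (<⇒≤ 0<1) (fromℕ-nonNeg n)

  fromℕ-mono : ∀ {m n} → m ℕ.≤ n → fromℕ m ≤ fromℕ n
  fromℕ-mono {n = n} ℕ.z≤n = fromℕ-nonNeg n
  fromℕ-mono (ℕ.s≤s m≤n)   = +-monoʳ-≤ 1ℚ (fromℕ-mono m≤n)

  toℚᵘ-fromℕ : ∀ n → ℚ.toℚᵘ (fromℕ n) ℚᵘ.≃ ℚᵘ.mkℚᵘ (+ n) 0
  toℚᵘ-fromℕ zero    = ℚᵘ.*≡* refl
  toℚᵘ-fromℕ (suc n) = ℚᵘₚ.≃-trans (toℚᵘ-homo-+ 1ℚ (fromℕ n))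
    (ℚᵘₚ.≃-trans (ℚᵘₚ.+-congʳ (ℚ.toℚᵘ 1ℚ) (toℚᵘ-fromℕ n))
      (ℚᵘ.*≡* (cong (λ i → (+ 1 ℤ.+ i) ℤ.* + 1) (ℤₚ.*-identityʳ (+ n)))))

  archimedean : ∀ p → Σ[ k ∈ ℕ ] p ≤ fromℕ k
  archimedean p@(mkℚ i d _) = ℤ.∣ i ∣ ,
    toℚᵘ-cancel-≤ (ℚᵘₚ.≤-respʳ-≃ (ℚᵘₚ.≃-sym (toℚᵘ-fromℕ ℤ.∣ i ∣)) (ℚᵘ.*≤* (bound i)))
    where
    bound : ∀ i → i ℤ.* + 1 ℤ.≤ + ℤ.∣ i ∣ ℤ.* + suc d
    bound (+ n)    = subst₂ ℤ._≤_ (ℤₚ.pos-* n 1) (ℤₚ.pos-* n (suc d))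
      (ℤ.+≤+ (ℕₚ.*-monoʳ-≤ n (ℕ.s≤s ℕ.z≤n)))
    bound -[1+ n ] = ℤ.-≤+

  half^≤1 : ∀ n → half^ n ≤ 1ℚ
  half^≤1 zero    = ≤-refl
  half^≤1 (suc n) = ≤-trans
    (*-monoˡ-≤-nonNeg ½ (half^≤1 n)) (≤ᵇ⇒≤ _)

  fromℕ*half^≤1 : ∀ n → fromℕ n * half^ n ≤ 1ℚ
  fromℕ*half^≤1 zero    = ≤ᵇ⇒≤ _
  fromℕ*half^≤1 (suc n) = ≤-trans (≤-reflexive (e (fromℕ n) (half^ n)))
    (*-monoˡ-≤-nonNeg ½ (+-mono-≤ (half^≤1 n) (fromℕ*half^≤1 n)))
    where
    e : ∀ m h → (1ℚ + m) * (½ * h) ≡ ½ * (h + m * h)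
    e = solve 2 (λ m h → (con 1ℚ :+ m) :* (con ½ :* h) := con ½ :* (h :+ m :* h)) refl

  half^→0 : ∀ {A ε} → 0ℚ < ε → Eventually (λ n → A * half^ n ≤ ε)
  half^→0 {A} {ε} 0<ε with archimedean (A * recip ε)
  ... | K , A/ε≤K = K , λ n K≤n → ≤-trans
    (*-monoʳ-≤-nonNeg (half^ n) {{ℚ.nonNegative (half^-nonNeg n)}}
      (≤-trans (≤-reflexive (sym cancel))
        (*-monoˡ-≤-nonNeg ε {{ε≥0}} (≤-trans A/ε≤K (fromℕ-mono K≤n)))))
    (≤-trans (≤-reflexive (*-assoc ε (fromℕ n) (half^ n)))
      (≤-trans (*-monoˡ-≤-nonNeg ε {{ε≥0}} (fromℕ*half^≤1 n)) (≤-reflexive (*-identityʳ ε))))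
    where
    ε≥0 = ℚ.nonNegative (<⇒≤ 0<ε)
    r : ∀ a e r → e * (a * r) ≡ (e * r) * a
    r = solve 3 (λ a e r → e :* (a :* r) := (e :* r) :* a) refl
    cancel : ε * (A * recip ε) ≡ A
    cancel = trans (r A ε (recip ε)) (trans (cong (_* A) (recip-inverse 0<ε)) (*-identityˡ A))

  clamp : ℚ → ℚ
  clamp p = p ⊔ 0ℚ

  clamp-nonNeg : ∀ p → 0ℚ ≤ clamp p
  clamp-nonNeg p = p≤q⊔p p 0ℚ

  clamp-diff : ∀ a b → clamp b - clamp a ≤ ∣ b - a ∣
  clamp-diff a b with ≤-total b 0ℚ
  ... | inj₁ b≤0 = ≤-trans
    (≤-trans (≤-reflexive (cong (_- clamp a) (p≤q⇒p⊔q≡q b≤0)))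
             (≤-by (clamp-nonNeg a) (e (clamp a))))
    (0≤∣p∣ (b - a))
    where
    e : ∀ u → u - 0ℚ ≡ 0ℚ - (0ℚ - u)
    e = solve 1 (λ u → u :- con 0ℚ := con 0ℚ :- (con 0ℚ :- u)) refl
  ... | inj₂ 0≤b = ≤-trans
    (≤-trans (≤-reflexive (cong (_- clamp a) (p≥q⇒p⊔q≡p 0≤b)))
             (+-monoʳ-≤ b (neg-antimono-≤ (p≤p⊔q a 0ℚ))))
    (p≤∣p∣ (b - a))

  clamp≤ : ∀ {p B} → ∣ p ∣ ≤ B → clamp p ≤ B
  clamp≤ {p} {B} p≤B = ⊔-lub (≤-trans (p≤∣p∣ p) p≤B) (≤-trans (0≤∣p∣ p) p≤B)

  approx : (ℕ → ℚ) → ℕ → ℚ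
  approx s n = proj₁ (bisect (clamp (s n)) n)

  gap : (ℕ → ℚ) → ℕ → ℚ
  gap s n = (clamp (s n) + 1ℚ) * half^ n

  brackets : ∀ s n → Bracket (clamp (s n)) (gap s n) (bisect (clamp (s n)) n)
  brackets s n = bracket (clamp-nonNeg (s n)) n

  below : ∀ s n → 0ℚ ≤ approx s n
  below s n = Bracket.lower≥0 (brackets s n)

  approx² : ∀ s n → approx s n * approx s n ≤ clamp (s n)
  approx² s n = Bracket.lower²≤ (brackets s n)

  above : ∀ s n {δ} → gap s n ≤ δ → clamp (s n) < (approx s n + δ) * (approx s n + δ)
  above s n {δ} g≤δ = <-≤-trans (Bracket.upper²> (brackets s n))
    (≤-trans (≤-reflexive (cong (λ h → h * h) (Bracket.width (brackets s n))))
      (*-mono 0≤ 0≤ le le))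
    where
    le = +-monoʳ-≤ (approx s n) g≤δ
    0≤ = +-nonNeg (below s n)
      (*-nonNeg (+-nonNeg (clamp-nonNeg (s n)) (<⇒≤ 0<1)) (half^-nonNeg n))

  gap→0 : ∀ x {ε} → 0ℚ < ε → Eventually (λ n → gap (seq x) n ≤ ε)
  gap→0 x {ε} 0<ε =
    let B , 0<B , b = bounded x
    in ev-zip (λ n → go n B) b (half^→0 {B + 1ℚ} 0<ε)
    where
    go : ∀ n B → ∣ seq x n ∣ ≤ B → (B + 1ℚ) * half^ n ≤ ε → gap (seq x) n ≤ ε
    go n B x≤B = ≤-trans
      (*-monoʳ-≤-nonNeg (half^ n) {{ℚ.nonNegative (half^-nonNeg n)}} {clamp (seq x n) + 1ℚ} {B + 1ℚ}
        (+-monoˡ-≤ 1ℚ (clamp≤ x≤B)))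

  approx-close : ∀ s m n {ε} → 0ℚ < ε → gap s m ≤ ½ * ε →
    ∣ s m - s n ∣ < (½ * ε) * (½ * ε) → approx s n - approx s m < ε
  approx-close s m n {ε} 0<ε g≤ close = <-by
    (sq-cancel-< {t} {a + ε} (+-nonNeg (below s m) (<⇒≤ 0<ε))
      (≤-<-trans (approx² s n) (<-≤-trans p′< bound)))
    (e₁ t a ε)
    where
    t = approx s n
    a = approx s m
    e₁ : ∀ t a ε → a + ε - t ≡ ε - (t - a)
    e₁ = solve 3 (λ t a ε → a :+ ε :- t := ε :- (t :- a)) refl
    e₂ : ∀ p p′ d b → d + b - (p′ - p + p) ≡ b + d - p′
    e₂ = solve 4 (λ p p′ d b → d :+ b :- (p′ :- p :+ p) := b :+ d :- p′) refl
    p′< : clamp (s n) < (a + ½ * ε) * (a + ½ * ε) + (½ * ε) * (½ * ε)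
    p′< = <-by
      (+-mono-< (≤-<-trans (clamp-diff (s m) (s n))
                  (subst (_< _) (∣-∣-comm (s m) (s n)) close))
                (above s m g≤))
      (e₂ (clamp (s m)) (clamp (s n)) ((½ * ε) * (½ * ε)) ((a + ½ * ε) * (a + ½ * ε)))
    bound : (a + ½ * ε) * (a + ½ * ε) + (½ * ε) * (½ * ε) ≤ (a + ε) * (a + ε)
    bound = ≤-by
      (+-nonNeg (*-nonNeg (below s m) (<⇒≤ 0<ε)) (*-nonNeg (<⇒≤ (half 0<ε)) (<⇒≤ 0<ε)))
      (e₃ a ε)
      where
      e₃ : ∀ a ε → a * ε + (½ * ε) * ε - (0ℚ + 0ℚ) ≡
             (a + ε) * (a + ε) - ((a + ½ * ε) * (a + ½ * ε) + (½ * ε) * (½ * ε))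
      e₃ = solve 2 (λ a ε → a :* ε :+ (con ½ :* ε) :* ε :- (con 0ℚ :+ con 0ℚ) :=
             (a :+ ε) :* (a :+ ε) :-
               ((a :+ con ½ :* ε) :* (a :+ con ½ :* ε) :+ (con ½ :* ε) :* (con ½ :* ε))) refl

  approx-cauchy : ∀ x → IsCauchy (approx (seq x))
  approx-cauchy x ε 0<ε = ev₂-zip
    (λ m n gg h → ∣∣<-intro
      (approx-close (seq x) n m 0<ε (proj₂ gg) (subst (_< _) (∣-∣-comm (seq x m) (seq x n)) h))
      (subst (_< ε) (flip (approx (seq x) m) (approx (seq x) n))
        (approx-close (seq x) m n 0<ε (proj₁ gg) h)))
    (ev₂-both (gap→0 x (half 0<ε)) (gap→0 x (half 0<ε)))
    (cauchy x ((½ * ε) * (½ * ε)) (*-pos (half 0<ε) (half 0<ε)))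
    where
    flip : ∀ a b → b - a ≡ - (a - b)
    flip = solve 2 (λ a b → b :- a := :- (a :- b)) refl

open SqrtLemmas using (approx; approx-cauchy)

-- The square root of max(x, 0).
infix 9 √_

√_ : ℝ → ℝ
√ x = mkℝ (λ n → proj₁ (bisect (seq x n ℚ.⊔ 0ℚ) n)) (approx-cauchy x)

module SqrtOrder where
  open ℚ using (_+_; _*_; -_; _-_; _<_; _≤_; _⊔_)
  open ℚₚ
  open SqrtLemmas
  open ℚSolver.+-*-Solver

  0<√x⇒0<x : ∀ {x} → 0ᵣ <ᵣ √ x → 0ᵣ <ᵣ x
  0<√x⇒0<x {x} (ε , 0<ε , h) = ε * ε , *-pos 0<ε 0<ε , ev-map go h
    where
    go : ∀ n → 0ℚ + ε ≤ approx (seq x) n → 0ℚ + ε * ε ≤ seq x n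
    go n ε≤ with ≤-total (seq x n) 0ℚ
    ... | inj₂ 0≤x = ≤-trans (≤-reflexive (+-identityˡ _))
      (≤-trans ε²≤ (≤-reflexive (p≥q⇒p⊔q≡p 0≤x)))
      where
      ε≤′ = subst (_≤ approx (seq x) n) (+-identityˡ ε) ε≤
      ε²≤ = ≤-trans (*-mono (<⇒≤ 0<ε) (<⇒≤ 0<ε) ε≤′ ε≤′) (approx² (seq x) n)
    ... | inj₁ x≤0 = ⊥-elim (<-irrefl refl (<-≤-trans (*-pos 0<ε 0<ε)
      (≤-trans ε²≤ (≤-reflexive (p≤q⇒p⊔q≡q x≤0)))))
      where
      ε≤′ = subst (_≤ approx (seq x) n) (+-identityˡ ε) ε≤
      ε²≤ = ≤-trans (*-mono (<⇒≤ 0<ε) (<⇒≤ 0<ε) ε≤′ ε≤′) (approx² (seq x) n)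

  √x<1⇒x<1 : ∀ {x} → √ x <ᵣ 1ᵣ → x <ᵣ 1ᵣ
  √x<1⇒x<1 {x} (ε , 0<ε , h) = ½ * ε , half 0<ε , ev-zip go h (gap→0 x (half 0<ε))
    where
    go : ∀ n → approx (seq x) n + ε ≤ 1ℚ → gap (seq x) n ≤ ½ * ε → seq x n + ½ * ε ≤ 1ℚ
    go n a+ε≤1 g = ≤-by
      (≤-trans (≤-trans (p≤p⊔q (seq x n) 0ℚ) (<⇒≤ (above (seq x) n g)))
        (≤-trans (*-mono 0≤r 0≤r r≤ r≤1) (≤-reflexive (*-identityʳ (1ℚ - ½ * ε)))))
      (e₁ (seq x n) ε)
      where
      a = approx (seq x) n
      0≤r : 0ℚ ≤ a + ½ * ε
      0≤r = +-nonNeg (below (seq x) n) (<⇒≤ (half 0<ε))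
      r≤ : a + ½ * ε ≤ 1ℚ - ½ * ε
      r≤ = ≤-by a+ε≤1 (e₂ a ε)
        where
        e₂ : ∀ a ε → 1ℚ - (a + ε) ≡ 1ℚ - ½ * ε - (a + ½ * ε)
        e₂ = solve 2 (λ a ε → con 1ℚ :- (a :+ ε) :=
               con 1ℚ :- con ½ :* ε :- (a :+ con ½ :* ε)) refl
      r≤1 : a + ½ * ε ≤ 1ℚ
      r≤1 = ≤-trans (+-monoʳ-≤ a (half≤ 0<ε)) a+ε≤1
      e₁ : ∀ x ε → 1ℚ - ½ * ε - x ≡ 1ℚ - (x + ½ * ε)
      e₁ = solve 2 (λ x ε → con 1ℚ :- con ½ :* ε :- x := con 1ℚ :- (x :+ con ½ :* ε)) refl

  √x*√x≈x : ∀ x → (∀ n → 0ℚ ≤ seq x n) → √ x *ᵣ √ x ≈ᵣ x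
  √x*√x≈x x 0≤x ε 0<ε =
    let B , 0<B , b = bounded x
        0<C = *-pos {1ℚ + (1ℚ + 1ℚ)} (positive⁻¹ _) (+-mono-< 0<B 0<1)
        η , 0<η , e = shrink 0<C 0<ε
    in ev-zip (λ n x≤B g → go n B η 0<C e x≤B g) b (gap→0 x 0<η)
    where
    go : ∀ n B η → 0ℚ < (1ℚ + (1ℚ + 1ℚ)) * (B + 1ℚ) → (1ℚ + (1ℚ + 1ℚ)) * (B + 1ℚ) * η ≡ ε →
      ℚ.∣ seq x n ∣ ≤ B → gap (seq x) n ≤ η → ℚ.∣ seq (√ x) n * seq (√ x) n - seq x n ∣ < ε
    go n B η 0<C e x≤B g = ∣∣<-intro
      (≤-<-trans (≤-by (approx² (seq x) n) (trans (cong (_- s * s) p≡) (e₀ (seq x n) (s * s)))) 0<ε)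
      (<-≤-trans
        (<-by (above (seq x) n ≤-refl) (trans (cong (λ p → (s + δ) * (s + δ) - p) p≡) (e₁ s δ (seq x n))))
        (≤-trans (*-mono (+-nonNeg 0≤δ (+-nonNeg 0≤s 0≤s)) 0≤δ bound g) (≤-reflexive (trans (cong (_* η) (e₂ (B + 1ℚ))) e))))
      where
      s = approx (seq x) n
      δ = gap (seq x) n
      p≡ : clamp (seq x n) ≡ seq x n
      p≡ = p≥q⇒p⊔q≡p (0≤x n)
      0≤p = clamp-nonNeg (seq x n)
      0≤s = below (seq x) n
      0≤p+1 = +-nonNeg 0≤p (<⇒≤ 0<1)
      0≤δ = *-nonNeg 0≤p+1 (half^-nonNeg n)
      p+1≤ : clamp (seq x n) + 1ℚ ≤ B + 1ℚ
      p+1≤ = +-monoˡ-≤ 1ℚ (clamp≤ x≤B)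
      δ≤ : δ ≤ B + 1ℚ
      δ≤ = ≤-trans (*-mono 0≤p+1 (half^-nonNeg n) p+1≤ (half^≤1 n)) (≤-reflexive (*-identityʳ (B + 1ℚ)))
      s≤ : s ≤ B + 1ℚ
      s≤ = ≤-trans (<⇒≤ (sq-cancel-< 0≤p+1
        (≤-<-trans (approx² (seq x) n) (Bracket.upper²> (bracket 0≤p 0))))) p+1≤
      bound : δ + (s + s) ≤ (B + 1ℚ) + ((B + 1ℚ) + (B + 1ℚ))
      bound = +-mono-≤ δ≤ (+-mono-≤ s≤ s≤)
      e₀ : ∀ p t → p - t ≡ 0ℚ - (t - p)
      e₀ = solve 2 (λ p t → p :- t := con 0ℚ :- (t :- p)) refl
      e₁ : ∀ s δ p → (s + δ) * (s + δ) - p ≡ (δ + (s + s)) * δ - (- (s * s - p))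
      e₁ = solve 3 (λ s δ p → (s :+ δ) :* (s :+ δ) :- p
             := (δ :+ (s :+ s)) :* δ :- (:- (s :* s :- p))) refl
      e₂ : ∀ c → c + (c + c) ≡ (1ℚ + (1ℚ + 1ℚ)) * c
      e₂ = solve 1 (λ c → c :+ (c :+ c) := (con 1ℚ :+ (con 1ℚ :+ con 1ℚ)) :* c) refl

open SqrtOrder

------------------------------------------------------------------------
-- Complex numbers

record ℂ : Set where
  constructor _+i_
  field
    re im : ℝ

open ℂ public

infix 4 _≈_

record _≈_ (z w : ℂ) : Set where
  constructor _,_
  field
    re≈ : re z ≈ᵣ re w
    im≈ : im z ≈ᵣ im w

open _≈_ public

infixl 6 _+_ _-_
infixl 7 _*_
infix  8 -_

0ℂ 1ℂ : ℂ
0ℂ = 0ᵣ +i 0ᵣ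
1ℂ = 1ᵣ +i 0ᵣ

_+_ : ℂ → ℂ → ℂ
z + w = (re z +ᵣ re w) +i (im z +ᵣ im w)

-_ : ℂ → ℂ
- z = (-ᵣ re z) +i (-ᵣ im z)

_-_ : ℂ → ℂ → ℂ
z - w = z + (- w)

_*_ : ℂ → ℂ → ℂ
z * w = (re z *ᵣ re w -ᵣ im z *ᵣ im w) +i (re z *ᵣ im w +ᵣ im z *ᵣ re w)

normSq : ℂ → ℝ
normSq z = re z *ᵣ re z +ᵣ im z *ᵣ im z

∣_∣ : ℂ → ℝ
∣ z ∣ = √ (normSq z)

pointwiseℂ : ∀ {z w} → (∀ n → seq (re z) n ≡ seq (re w) n) →
  (∀ n → seq (im z) n ≡ seq (im w) n) → z ≈ w
pointwiseℂ {z} {w} p q = pointwise {re z} {re w} p , pointwise {im z} {im w} q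

ℂ-commutativeRing : CommutativeRing 0ℓ 0ℓ
ℂ-commutativeRing = record
  { Carrier = ℂ ; _≈_ = _≈_ ; _+_ = _+_ ; _*_ = _*_ ; -_ = -_ ; 0# = 0ℂ ; 1# = 1ℂ
  ; isCommutativeRing = record
    { isRing = record
      { +-isAbelianGroup = record
        { isGroup = record
          { isMonoid = record
            { isSemigroup = record
              { isMagma = record
                { isEquivalence = record
                  { refl  = λ {z} → ≈ᵣ-refl {re z} , ≈ᵣ-refl {im z}
                  ; sym   = λ {z} {w} p →
                      ≈ᵣ-sym {re z} {re w} (re≈ p) , ≈ᵣ-sym {im z} {im w} (im≈ p)
                  ; trans = λ {z} {w} {v} p q →
                      ≈ᵣ-trans {re z} {re w} {re v} (re≈ p) (re≈ q) ,
                      ≈ᵣ-trans {im z} {im w} {im v} (im≈ p) (im≈ q)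
                  }
                ; ∙-cong = λ {z} {z′} {w} {w′} p q →
                    +ᵣ-cong {re z} {re z′} {re w} {re w′} (re≈ p) (re≈ q) ,
                    +ᵣ-cong {im z} {im z′} {im w} {im w′} (im≈ p) (im≈ q)
                }
              ; assoc = λ z w v → pointwiseℂ
                  (λ n → ℚₚ.+-assoc (seq (re z) n) (seq (re w) n) (seq (re v) n))
                  (λ n → ℚₚ.+-assoc (seq (im z) n) (seq (im w) n) (seq (im v) n))
              }
            ; identity =
                (λ z → pointwiseℂ (λ n → ℚₚ.+-identityˡ (seq (re z) n))
                                  (λ n → ℚₚ.+-identityˡ (seq (im z) n)))
              , (λ z → pointwiseℂ (λ n → ℚₚ.+-identityʳ (seq (re z) n))
                                  (λ n → ℚₚ.+-identityʳ (seq (im z) n)))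
            }
          ; inverse =
              (λ z → pointwiseℂ (λ n → ℚₚ.+-inverseˡ (seq (re z) n))
                                (λ n → ℚₚ.+-inverseˡ (seq (im z) n)))
            , (λ z → pointwiseℂ (λ n → ℚₚ.+-inverseʳ (seq (re z) n))
                                (λ n → ℚₚ.+-inverseʳ (seq (im z) n)))
          ; ⁻¹-cong = λ {z} {w} p →
              -ᵣ-cong {re z} {re w} (re≈ p) , -ᵣ-cong {im z} {im w} (im≈ p)
          }
        ; comm = λ z w → pointwiseℂ
            (λ n → ℚₚ.+-comm (seq (re z) n) (seq (re w) n))
            (λ n → ℚₚ.+-comm (seq (im z) n) (seq (im w) n))
        }
      ; *-cong = λ {z} {z′} {w} {w′} p q → *-cong {z} {z′} {w} {w′} p q
      ; *-assoc = λ z w v → pointwiseℂ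
          (λ n → re-assoc (seq (re z) n) (seq (im z) n) (seq (re w) n) (seq (im w) n)
                          (seq (re v) n) (seq (im v) n))
          (λ n → im-assoc (seq (re z) n) (seq (im z) n) (seq (re w) n) (seq (im w) n)
                          (seq (re v) n) (seq (im v) n))
      ; *-identity =
          (λ z → pointwiseℂ (λ n → re-identityˡ (seq (re z) n) (seq (im z) n))
                            (λ n → im-identityˡ (seq (re z) n) (seq (im z) n)))
        , (λ z → pointwiseℂ (λ n → re-identityʳ (seq (re z) n) (seq (im z) n))
                            (λ n → im-identityʳ (seq (re z) n) (seq (im z) n)))
      ; distrib =
          (λ z w v → pointwiseℂ
            (λ n → re-distribˡ (seq (re z) n) (seq (im z) n) (seq (re w) n) (seq (im w) n)
                               (seq (re v) n) (seq (im v) n))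
            (λ n → im-distribˡ (seq (re z) n) (seq (im z) n) (seq (re w) n) (seq (im w) n)
                               (seq (re v) n) (seq (im v) n)))
        , (λ z w v → pointwiseℂ
            (λ n → re-distribʳ (seq (re z) n) (seq (im z) n) (seq (re w) n) (seq (im w) n)
                               (seq (re v) n) (seq (im v) n))
            (λ n → im-distribʳ (seq (re z) n) (seq (im z) n) (seq (re w) n) (seq (im w) n)
                               (seq (re v) n) (seq (im v) n)))
      }
    ; *-comm = λ z w → pointwiseℂ
        (λ n → re-comm (seq (re z) n) (seq (im z) n) (seq (re w) n) (seq (im w) n))
        (λ n → im-comm (seq (re z) n) (seq (im z) n) (seq (re w) n) (seq (im w) n))
    }
  }
  where
  open ℚSolver.+-*-Solver

  *-cong : ∀ {z z′ w w′} → z ≈ z′ → w ≈ w′ → z * w ≈ z′ * w′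
  *-cong {a +i b} {a′ +i b′} {c +i d} {c′ +i d′} (p , q) (r , s) =
    +ᵣ-cong {a *ᵣ c} {a′ *ᵣ c′} { -ᵣ (b *ᵣ d)} { -ᵣ (b′ *ᵣ d′)}
      (*ᵣ-cong {a} {a′} {c} {c′} p r)
      (-ᵣ-cong {b *ᵣ d} {b′ *ᵣ d′} (*ᵣ-cong {b} {b′} {d} {d′} q s)) ,
    +ᵣ-cong {a *ᵣ d} {a′ *ᵣ d′} {b *ᵣ c} {b′ *ᵣ c′}
      (*ᵣ-cong {a} {a′} {d} {d′} p s) (*ᵣ-cong {b} {b′} {c} {c′} q r)

  reP : ∀ {m} (a b c d : Polynomial m) → Polynomial m
  reP a b c d = a :* c :- b :* d
  imP : ∀ {m} (a b c d : Polynomial m) → Polynomial m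
  imP a b c d = a :* d :+ b :* c

  reQ imQ : (a b c d : ℚ) → ℚ
  reQ a b c d = a ℚ.* c ℚ.- b ℚ.* d
  imQ a b c d = a ℚ.* d ℚ.+ b ℚ.* c

  re-assoc : ∀ a b c d e f →
    reQ (reQ a b c d) (imQ a b c d) e f ≡ reQ a b (reQ c d e f) (imQ c d e f)
  re-assoc = solve 6 (λ a b c d e f →
    reP (reP a b c d) (imP a b c d) e f := reP a b (reP c d e f) (imP c d e f)) refl
  im-assoc : ∀ a b c d e f →
    imQ (reQ a b c d) (imQ a b c d) e f ≡ imQ a b (reQ c d e f) (imQ c d e f)
  im-assoc = solve 6 (λ a b c d e f →
    imP (reP a b c d) (imP a b c d) e f := imP a b (reP c d e f) (imP c d e f)) refl

  re-identityˡ : ∀ a b → reQ 1ℚ 0ℚ a b ≡ a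
  re-identityˡ = solve 2 (λ a b → reP (con 1ℚ) (con 0ℚ) a b := a) refl
  im-identityˡ : ∀ a b → imQ 1ℚ 0ℚ a b ≡ b
  im-identityˡ = solve 2 (λ a b → imP (con 1ℚ) (con 0ℚ) a b := b) refl
  re-identityʳ : ∀ a b → reQ a b 1ℚ 0ℚ ≡ a
  re-identityʳ = solve 2 (λ a b → reP a b (con 1ℚ) (con 0ℚ) := a) refl
  im-identityʳ : ∀ a b → imQ a b 1ℚ 0ℚ ≡ b
  im-identityʳ = solve 2 (λ a b → imP a b (con 1ℚ) (con 0ℚ) := b) refl

  re-distribˡ : ∀ a b c d e f →
    reQ a b (c ℚ.+ e) (d ℚ.+ f) ≡ reQ a b c d ℚ.+ reQ a b e f
  re-distribˡ = solve 6 (λ a b c d e f →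
    reP a b (c :+ e) (d :+ f) := reP a b c d :+ reP a b e f) refl
  im-distribˡ : ∀ a b c d e f →
    imQ a b (c ℚ.+ e) (d ℚ.+ f) ≡ imQ a b c d ℚ.+ imQ a b e f
  im-distribˡ = solve 6 (λ a b c d e f →
    imP a b (c :+ e) (d :+ f) := imP a b c d :+ imP a b e f) refl
  re-distribʳ : ∀ a b c d e f →
    reQ (c ℚ.+ e) (d ℚ.+ f) a b ≡ reQ c d a b ℚ.+ reQ e f a b
  re-distribʳ = solve 6 (λ a b c d e f →
    reP (c :+ e) (d :+ f) a b := reP c d a b :+ reP e f a b) refl
  im-distribʳ : ∀ a b c d e f →
    imQ (c ℚ.+ e) (d ℚ.+ f) a b ≡ imQ c d a b ℚ.+ imQ e f a b
  im-distribʳ = solve 6 (λ a b c d e f →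
    imP (c :+ e) (d :+ f) a b := imP c d a b :+ imP e f a b) refl

  re-comm : ∀ a b c d → reQ a b c d ≡ reQ c d a b
  re-comm = solve 4 (λ a b c d → reP a b c d := reP c d a b) refl
  im-comm : ∀ a b c d → imQ a b c d ≡ imQ c d a b
  im-comm = solve 4 (λ a b c d → imP a b c d := imP c d a b) refl

open RawSemiringDefinitions 
  (Semiring.rawSemiring (CommutativeRing.semiring ℂ-commutativeRing)) public
  using (sum; product; _^_)

NonZero : ℂ → Set
NonZero z = 0ᵣ <ᵣ normSq z

infix  9 _⁻¹[_]
infixl 7 _÷_[_]
infixr 8 _^[_]_

_⁻¹[_] : (z : ℂ) → NonZero z → ℂ
z ⁻¹[ z≠0 ] = (re z *ᵣ r) +i (-ᵣ (im z *ᵣ r))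
  where r = recipᵣ (normSq z) z≠0

_÷_[_] : (w z : ℂ) → NonZero z → ℂ
w ÷ z [ z≠0 ] = w * z ⁻¹[ z≠0 ]

_^[_]_ : (z : ℂ) → NonZero z → ℤ → ℂ
z ^[ _ ]   (+ n)    = z ^ n
z ^[ z≠0 ] -[1+ n ] = z ⁻¹[ z≠0 ] ^ suc n

⁻¹-inverseʳ : ∀ z (z≠0 : NonZero z) → z * z ⁻¹[ z≠0 ] ≈ 1ℂ
⁻¹-inverseʳ z@(a +i b) z≠0@(d , 0<d , h) =
  ≡⇒≈ᵣ {re (z * z ⁻¹[ z≠0 ])} {1ᵣ} (ev-map (λ n d≤ → trans
    (re-eq (seq a n) (seq b n) (recip (seq (normSq z) n)))
    (recip-inverse (ℚₚ.<-≤-trans 0<d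
      (subst (ℚ._≤ seq (normSq z) n) (ℚₚ.+-identityˡ d) d≤)))) h) ,
  pointwise {im (z * z ⁻¹[ z≠0 ])} {0ᵣ} (λ n →
    im-eq (seq a n) (seq b n) (recip (seq (normSq z) n)))
  where
  open ℚSolver.+-*-Solver
  re-eq : ∀ a b r →
    a ℚ.* (a ℚ.* r) ℚ.- b ℚ.* (ℚ.- (b ℚ.* r)) ≡ (a ℚ.* a ℚ.+ b ℚ.* b) ℚ.* r
  re-eq = solve 3 (λ a b r →
    a :* (a :* r) :- b :* (:- (b :* r)) := (a :* a :+ b :* b) :* r) refl
  im-eq : ∀ a b r → a ℚ.* (ℚ.- (b ℚ.* r)) ℚ.+ b ℚ.* (a ℚ.* r) ≡ 0ℚ
  im-eq = solve 3 (λ a b r → a :* (:- (b :* r)) :+ b :* (a :* r) := con 0ℚ) refl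

------------------------------------------------------------------------
-- Non-vanishing of the denominators

0<∣z∣⇒nonZero : ∀ z → 0ᵣ <ᵣ ∣ z ∣ → NonZero z
0<∣z∣⇒nonZero z = 0<√x⇒0<x {normSq z}

∣z∣<1⇒normSq<1 : ∀ z → ∣ z ∣ <ᵣ 1ᵣ → normSq z <ᵣ 1ᵣ
∣z∣<1⇒normSq<1 z = √x<1⇒x<1 {normSq z}

normSq-* : ∀ z w n → seq (normSq (z * w)) n ≡ seq (normSq z) n ℚ.* seq (normSq w) n
normSq-* (a +i b) (c +i d) n = e (seq a n) (seq b n) (seq c n) (seq d n)
  where
  open ℚSolver.+-*-Solver
  e : ∀ a b c d →
    (a ℚ.* c ℚ.- b ℚ.* d) ℚ.* (a ℚ.* c ℚ.- b ℚ.* d)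
      ℚ.+ (a ℚ.* d ℚ.+ b ℚ.* c) ℚ.* (a ℚ.* d ℚ.+ b ℚ.* c)
    ≡ (a ℚ.* a ℚ.+ b ℚ.* b) ℚ.* (c ℚ.* c ℚ.+ d ℚ.* d)
  e = solve 4 (λ a b c d →
    (a :* c :- b :* d) :* (a :* c :- b :* d) :+ (a :* d :+ b :* c) :* (a :* d :+ b :* c)
    := (a :* a :+ b :* b) :* (c :* c :+ d :* d)) refl

normSq-nonNeg : ∀ z n → 0ℚ ℚ.≤ seq (normSq z) n
normSq-nonNeg (a +i b) n = +-nonNeg (sq-nonNeg (seq a n)) (sq-nonNeg (seq b n))

∣z∣*∣z∣≈normSq : ∀ z → ∣ z ∣ *ᵣ ∣ z ∣ ≈ᵣ normSq z
∣z∣*∣z∣≈normSq z = √x*√x≈x (normSq z) (normSq-nonNeg z)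

nonZero-1 : NonZero 1ℂ
nonZero-1 = 1ℚ , 0<1 , 0 , λ _ _ → ℚₚ.≤ᵇ⇒≤ _

nonZero-* : ∀ z w → NonZero z → NonZero w → NonZero (z * w)
nonZero-* z w (δ , 0<δ , h) (ε , 0<ε , k) = δ ℚ.* ε , *-pos 0<δ 0<ε , ev-zip
  (λ n p q → subst₂ ℚ._≤_ (sym (ℚₚ.+-identityˡ (δ ℚ.* ε))) (sym (normSq-* z w n))
    (*-mono (ℚₚ.<⇒≤ 0<δ) (ℚₚ.<⇒≤ 0<ε)
      (subst (ℚ._≤ seq (normSq z) n) (ℚₚ.+-identityˡ δ) p)
      (subst (ℚ._≤ seq (normSq w) n) (ℚₚ.+-identityˡ ε) q)))
  h k

nonZero-product : ∀ n (f : Fin n → ℂ) → (∀ i → NonZero (f i)) → NonZero (product f)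
nonZero-product zero    f h = nonZero-1
nonZero-product (suc n) f h = nonZero-* (f zero) (product (λ i → f (suc i)))
  (h zero) (nonZero-product n (λ i → f (suc i)) (λ i → h (suc i)))

normSq<1-* : ∀ z w → normSq z <ᵣ 1ᵣ → normSq w <ᵣ 1ᵣ → normSq (z * w) <ᵣ 1ᵣ
normSq<1-* z w (δ , 0<δ , h) (ε , 0<ε , k) = ε , 0<ε , ev-zip go h k
  where
  go : ∀ n → seq (normSq z) n ℚ.+ δ ℚ.≤ 1ℚ → seq (normSq w) n ℚ.+ ε ℚ.≤ 1ℚ →
    seq (normSq (z * w)) n ℚ.+ ε ℚ.≤ 1ℚ
  go n p q = ℚₚ.≤-trans (ℚₚ.+-monoˡ-≤ ε zw≤w) q
    where
    u v : ℚ
    u = seq (normSq z) n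
    v = seq (normSq w) n
    u≤1 : u ℚ.≤ 1ℚ
    u≤1 = ℚₚ.≤-trans
      (ℚₚ.≤-trans (ℚₚ.≤-reflexive (sym (ℚₚ.+-identityʳ u))) (ℚₚ.+-monoʳ-≤ u (ℚₚ.<⇒≤ 0<δ))) p
    zw≤w : seq (normSq (z * w)) n ℚ.≤ v
    zw≤w = subst₂ ℚ._≤_ (sym (normSq-* z w n)) (ℚₚ.*-identityˡ v)
      (ℚₚ.*-monoʳ-≤-nonNeg v {{ℚ.nonNegative (normSq-nonNeg w n)}} u≤1)

normSq<1-power : ∀ q → normSq q <ᵣ 1ᵣ → ∀ j → normSq (q * q ^ j) <ᵣ 1ᵣ
normSq<1-power q h@(δ , 0<δ , k) zero = δ , 0<δ , ev-map
  (λ n → subst (λ u → u ℚ.+ δ ℚ.≤ 1ℚ)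
    (sym (trans (normSq-* q 1ℂ n) (ℚₚ.*-identityʳ (seq (normSq q) n))))) k
normSq<1-power q h (suc j) = normSq<1-* q (q ^ suc j) h (normSq<1-power q h j)

nonZero-1- : ∀ w → normSq w <ᵣ 1ᵣ → NonZero (1ℂ - w)
nonZero-1- (a +i b) (ε , 0<ε , h) =
  (½ ℚ.* ε) ℚ.* (½ ℚ.* ε) , *-pos (half 0<ε) (half 0<ε) ,
  ev-map (λ n → go (seq a n) (seq b n)) h
  where
  open ℚ using () renaming (_+_ to _⊕_; _*_ to _⊗_; _-_ to _⊖_; -_ to ⊝_)
  open ℚSolver.+-*-Solver
  go : ∀ a b → a ⊗ a ⊕ b ⊗ b ⊕ ε ℚ.≤ 1ℚ →
    0ℚ ⊕ (½ ⊗ ε) ⊗ (½ ⊗ ε) ℚ.≤ (1ℚ ⊖ a) ⊗ (1ℚ ⊖ a) ⊕ (0ℚ ⊖ b) ⊗ (0ℚ ⊖ b)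
  go a b p = ℚₚ.≤-trans (ℚₚ.≤-reflexive (ℚₚ.+-comm 0ℚ ((½ ⊗ ε) ⊗ (½ ⊗ ε))))
    (ℚₚ.+-mono-≤ (*-mono 0≤½ε 0≤½ε ½ε≤1-a ½ε≤1-a) (sq-nonNeg (0ℚ ⊖ b)))
    where
    0≤½ε : 0ℚ ℚ.≤ ½ ⊗ ε
    0≤½ε = ℚₚ.<⇒≤ (half 0<ε)
    ½ε≤1 : ½ ⊗ ε ℚ.≤ 1ℚ
    ½ε≤1 = ℚₚ.≤-trans (half≤ 0<ε) (ℚₚ.≤-trans
      (ℚₚ.≤-trans (ℚₚ.≤-reflexive (sym (ℚₚ.+-identityˡ ε)))
        (ℚₚ.+-monoˡ-≤ ε (+-nonNeg (sq-nonNeg a) (sq-nonNeg b)))) p)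
    0≤1-½ε : 0ℚ ℚ.≤ 1ℚ ⊖ ½ ⊗ ε
    0≤1-½ε = ≤-by ½ε≤1 (e (½ ⊗ ε))
      where
      e : ∀ x → 1ℚ ⊖ x ≡ 1ℚ ⊖ x ⊖ 0ℚ
      e = solve 1 (λ x → con 1ℚ :- x := con 1ℚ :- x :- con 0ℚ) refl
    a²< : a ⊗ a ℚ.< (1ℚ ⊖ ½ ⊗ ε) ⊗ (1ℚ ⊖ ½ ⊗ ε)
    a²< = <-by (ℚₚ.+-mono-≤-< (ℚₚ.+-mono-≤ p (sq-nonNeg b)) (*-pos (half 0<ε) (half 0<ε)))
      (e a b ε)
      where
      e : ∀ a b ε →
        (1ℚ ⊕ b ⊗ b) ⊕ (½ ⊗ ε) ⊗ (½ ⊗ ε) ⊖ ((a ⊗ a ⊕ b ⊗ b ⊕ ε ⊕ 0ℚ) ⊕ 0ℚ)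
        ≡ (1ℚ ⊖ ½ ⊗ ε) ⊗ (1ℚ ⊖ ½ ⊗ ε) ⊖ a ⊗ a
      e = solve 3 (λ a b ε →
        (con 1ℚ :+ b :* b) :+ (con ½ :* ε) :* (con ½ :* ε)
          :- ((a :* a :+ b :* b :+ ε :+ con 0ℚ) :+ con 0ℚ)
        := (con 1ℚ :- con ½ :* ε) :* (con 1ℚ :- con ½ :* ε) :- a :* a) refl
    ½ε≤1-a : ½ ⊗ ε ℚ.≤ 1ℚ ⊖ a
    ½ε≤1-a = ≤-by (ℚₚ.<⇒≤ (sq-cancel-< 0≤1-½ε a²<)) (e a (½ ⊗ ε))
      where
      e : ∀ a x → 1ℚ ⊖ x ⊖ a ≡ 1ℚ ⊖ a ⊖ x
      e = solve 2 (λ a x → con 1ℚ :- x :- a := con 1ℚ :- a :- x) refl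

------------------------------------------------------------------------
-- q-Pochhammer symbols and bilateral Bailey pairs

-- (a; q)ₙ
poch : ℂ → ℂ → ℕ → ℂ
poch a q n = product {n} (λ j → 1ℂ - a * q ^ toℕ j)

poch-q-nonZero : ∀ q → ∣ q ∣ <ᵣ 1ᵣ → ∀ n → NonZero (poch q q n)
poch-q-nonZero q ∣q∣<1 n = nonZero-product n (λ j → 1ℂ - q * q ^ toℕ j)
  (λ j → nonZero-1- (q * q ^ toℕ j) (normSq<1-power q (∣z∣<1⇒normSq<1 q ∣q∣<1) (toℕ j)))

binom₂ : ℤ → ℤ
binom₂ m = (m ℤ.* (m ℤ.- + 1)) ℤ./ + 2

count : ℤ → ℕ
count (+ n)    = n
count -[1+ _ ] = 0

-- The sum of f k over lo ≤ k ≤ hi.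
∑ : (lo hi : ℤ) → (ℤ → ℂ) → ℂ
∑ lo hi f = sum {count (hi ℤ.+ + 1 ℤ.- lo)} (λ j → f (lo ℤ.+ + toℕ j))

-- The asymmetric bilateral Bailey pairs with a = 1 and λ = 1.  The lower limit
-- -[1+ n ] is -n-1, and both Pochhammer indices are non-negative in the range
-- of summation, so taking their absolute values leaves them unchanged.
IsAsymmetricBilateralBaileyPair :
  (q : ℂ) → (∀ n → NonZero (poch q q n)) → (ℤ → ℂ) → (ℕ → ℂ) → Set
IsAsymmetricBilateralBaileyPair q nz α β = ∀ (n : ℕ) →
  β n ≈ ∑ -[1+ n ] (+ n) (λ k →
    let i = ℤ.∣ + n ℤ.- k ∣
        j = ℤ.∣ + n ℤ.+ k ℤ.+ + 1 ∣
    in α k ÷ (poch q q i * poch q q j) [ nonZero-* (poch q q i) (poch q q j) (nz i) (nz j) ])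

alpha : (q z : ℂ) → 0ᵣ <ᵣ ∣ q ∣ → 0ᵣ <ᵣ ∣ z ∣ → ∣ z ∣ <ᵣ 1ᵣ → ℤ → ℂ
alpha q z 0<∣q∣ 0<∣z∣ ∣z∣<1 n =
  (z ^[ z≠0 ] (ℤ.- n) * q ^[ q≠0 ] binom₂ n * (1ℂ - q ^[ q≠0 ] (+ 2 ℤ.* n ℤ.+ + 1)))
    ÷ (1ℂ - z) [ 1-z≠0 ]
  where
  q≠0 = 0<∣z∣⇒nonZero q 0<∣q∣
  z≠0 = 0<∣z∣⇒nonZero z 0<∣z∣
  1-z≠0 = nonZero-1- z (∣z∣<1⇒normSq<1 z ∣z∣<1)

beta : (q z : ℂ) → ∣ q ∣ <ᵣ 1ᵣ → 0ᵣ <ᵣ ∣ z ∣ → ℕ → ℂ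
beta q z ∣q∣<1 0<∣z∣ n =
  (poch (- z) q n * poch (- (1ℂ ÷ z [ z≠0 ])) q n)
    ÷ poch q q (2 ℕ.* n) [ poch-q-nonZero q ∣q∣<1 (2 ℕ.* n) ]
  where z≠0 = 0<∣z∣⇒nonZero z 0<∣z∣

{-# OPTIONS --safe #-}
module Submission where

-- Put u = 1/z and k = j - n - 1.  Multiplied by (q)₂ₙ₊₁, the right-hand side has as its j-th
-- term a multiple of the Gaussian binomial [2n+1, j], and since C(k,2) + 2k + 1 = C(k+2,2) the
-- factor 1 - q²ᵏ⁺¹ splits it into the difference of two sums
--   Σ [2n+1, j] q^C(j-n-1,2) uʲ  and  Σ [2n+1, j] q^C(j+1-n,2) uʲ.
-- The finite Jacobi triple product evaluates both.  The two products share the factor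
-- F = ∏_{i<n} (u + qⁱ)(1 + uqⁱ), and what remains is (u - 1)(1 - q²ⁿ⁺¹); finally
-- zⁿ F = (-z)ₙ (-1/z)ₙ and z (u - 1) = 1 - z.

open import Algebra.Bundles using (CommutativeRing; Semiring)
open import Algebra.Core using (Op₁; Op₂)
import Algebra.Definitions.RawSemiring as RawSemiringDefinitions
import Algebra.Properties.Monoid.Sum as MonoidSum
open import Algebra.Structures using (IsCommutativeRing)
open import Data.Fin.Base using (Fin; toℕ)
import Data.Fin.Properties as Finₚ
open import Data.Integer.Base as ℤ using (ℤ; +_; -[1+_])
import Data.Integer.DivMod as ℤ
import Data.Integer.Properties as ℤₚ
import Data.Integer.Solver as ℤSolver
open import Data.Nat.Base as ℕ using (ℕ; zero; suc)
import Data.Nat.DivMod as ℕ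
import Data.Nat.Properties as ℕₚ
import Data.Nat.Solver as ℕSolver
open import Relation.Binary.Core using (Rel)
open import Relation.Binary.PropositionalEquality as ≡ using (_≡_)

-- Binomial exponents and index arithmetic for k = j - n - 1.

-- C(j - n, 2), which is a natural number even when j < n.
shiftedBinom₂ : ℕ → ℕ → ℕ
shiftedBinom₂ zero    zero    = 0
shiftedBinom₂ zero    (suc j) = j ℕ.+ shiftedBinom₂ zero j
shiftedBinom₂ (suc n) zero    = suc n ℕ.+ shiftedBinom₂ n zero
shiftedBinom₂ (suc n) (suc j) = shiftedBinom₂ n j

-- This is C(i+1,2) - C(i,2) = i at i = j - n, with the subtracted n moved across so that it lives
-- in ℕ. The exponent comparisons of the triple products rest on it.
shiftedBinom₂-suc : ∀ n j → n ℕ.+ shiftedBinom₂ n (suc j) ≡ j ℕ.+ shiftedBinom₂ n j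
shiftedBinom₂-suc zero    j       = ≡.refl
shiftedBinom₂-suc (suc n) zero    = ≡.refl
shiftedBinom₂-suc (suc n) (suc j) = ≡.cong suc (shiftedBinom₂-suc n j)

-- With k = j - n - 1 this is C(k,2) + 2k + 1 = C(k+2,2): two uses of the recurrence, passing
-- through C(k+1,2).
shiftedBinom₂-double : ∀ n j →
  shiftedBinom₂ (suc n) j ℕ.+ (j ℕ.+ j) ≡ shiftedBinom₂ n (suc j) ℕ.+ suc (n ℕ.+ n)
shiftedBinom₂-double n j = begin
  c ℕ.+ (j ℕ.+ j)                       ≡⟨ solve 2 (λ c j → c :+ (j :+ j) := (j :+ c) :+ j) ≡.refl c j ⟩
  (j ℕ.+ c) ℕ.+ j                       ≡⟨ ≡.cong (ℕ._+ j) (≡.sym (shiftedBinom₂-suc (suc n) j)) ⟩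
  (suc n ℕ.+ shiftedBinom₂ n j) ℕ.+ j   ≡⟨ solve 3 (λ n d j → (con 1 :+ n :+ d) :+ j := con 1 :+ n :+ (j :+ d))
                                             ≡.refl n (shiftedBinom₂ n j) j ⟩
  suc n ℕ.+ (j ℕ.+ shiftedBinom₂ n j)   ≡⟨ ≡.cong (suc n ℕ.+_) (≡.sym (shiftedBinom₂-suc n j)) ⟩
  suc n ℕ.+ (n ℕ.+ c′)                  ≡⟨ solve 2 (λ n c → con 1 :+ n :+ (n :+ c) := c :+ (con 1 :+ (n :+ n))) ≡.refl n c′ ⟩
  c′ ℕ.+ suc (n ℕ.+ n)                  ∎
  where
  open ≡.≡-Reasoning
  open ℕSolver.+-*-Solver
  c c′ : ℕ
  c = shiftedBinom₂ (suc n) j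
  c′ = shiftedBinom₂ n (suc j)

-- The symmetry C(i,2) = C(1-i,2) at i = n + 1.
shiftedBinom₂-reflect : ∀ n → shiftedBinom₂ 0 (suc n) ≡ shiftedBinom₂ n 0
shiftedBinom₂-reflect zero    = ≡.refl
shiftedBinom₂-reflect (suc n) = ≡.cong (suc n ℕ.+_) (shiftedBinom₂-reflect n)

shiftedBinom₂-*2 : ∀ n → suc n ℕ.* n ≡ shiftedBinom₂ n 0 ℕ.* 2
shiftedBinom₂-*2 zero    = ≡.refl
shiftedBinom₂-*2 (suc n) = ≡.trans
  (solve 1 (λ n → (con 2 :+ n) :* (con 1 :+ n) := (con 1 :+ n) :* con 2 :+ (con 1 :+ n) :* n) ≡.refl n)
  (≡.trans (≡.cong (suc n ℕ.* 2 ℕ.+_) (shiftedBinom₂-*2 n))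
    (≡.sym (ℕₚ.*-distribʳ-+ 2 (suc n) (shiftedBinom₂ n 0))))
  where open ℕSolver.+-*-Solver

shiftedBinom₂-ℤ : ∀ n j → (j ℤ.⊖ n) ℤ.* (j ℤ.⊖ n ℤ.- + 1) ≡ + (shiftedBinom₂ n j ℕ.* 2)
shiftedBinom₂-ℤ zero    zero    = ≡.refl
shiftedBinom₂-ℤ zero    (suc j) = ≡.trans (≡.sym (ℤₚ.pos-* (suc j) j)) (≡.cong +_
  (≡.trans (shiftedBinom₂-*2 j) (≡.cong (ℕ._* 2) (≡.sym (shiftedBinom₂-reflect j)))))
-- Here `-[1+ n ] - + 1` computes to `-[1+ suc (n + 0) ]`, hence the `+-identityʳ`.
shiftedBinom₂-ℤ (suc n) zero    = ≡.cong +_ (≡.trans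
  (≡.cong (λ m → suc n ℕ.* suc (suc m)) (ℕₚ.+-identityʳ n))
  (≡.trans (ℕₚ.*-comm (suc n) (suc (suc n))) (shiftedBinom₂-*2 (suc n))))
shiftedBinom₂-ℤ (suc n) (suc j) =
  ≡.trans (≡.cong (λ k → k ℤ.* (k ℤ.- + 1)) (ℤₚ.[1+m]⊖[1+n]≡m⊖n j n)) (shiftedBinom₂-ℤ n j)

-- For k = j - n - 1 the Pochhammer indices n - k and n + k + 1 become 2n+1-j and j, the
-- complementary pair of the Gaussian binomial [2n+1, j].
n-[j⊖1+n] : ∀ n j → j ℕ.≤ suc (n ℕ.+ n) → + n ℤ.- (j ℤ.⊖ suc n) ≡ + (suc (n ℕ.+ n) ℕ.∸ j)
n-[j⊖1+n] n j j≤ = begin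
  + n ℤ.- (j ℤ.⊖ suc n)        ≡⟨ ≡.cong (λ k → + n ℤ.+ k) (ℤₚ.⊖-swap (suc n) j) ⟨
  + n ℤ.+ (suc n ℤ.⊖ j)        ≡⟨ ℤₚ.distribʳ-⊖-+-pos n (suc n) j ⟩
  (n ℕ.+ suc n) ℤ.⊖ j          ≡⟨ ≡.cong (ℤ._⊖ j) (ℕₚ.+-suc n n) ⟩
  suc (n ℕ.+ n) ℤ.⊖ j          ≡⟨ ℤₚ.⊖-≥ j≤ ⟩
  + (suc (n ℕ.+ n) ℕ.∸ j)      ∎
  where open ≡.≡-Reasoning

n+[j⊖1+n]+1 : ∀ n j → + n ℤ.+ (j ℤ.⊖ suc n) ℤ.+ + 1 ≡ + j
n+[j⊖1+n]+1 n j = begin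
  + n ℤ.+ (j ℤ.⊖ suc n) ℤ.+ + 1      ≡⟨ ≡.cong (λ k → + n ℤ.+ k ℤ.+ + 1) (ℤₚ.m-n≡m⊖n j (suc n)) ⟨
  + n ℤ.+ (+ j ℤ.- + suc n) ℤ.+ + 1  ≡⟨ solve 2 (λ n j → n :+ (j :- (con (+ 1) :+ n)) :+ con (+ 1) := j) ≡.refl (+ n) (+ j) ⟩
  + j                                ∎
  where
  open ≡.≡-Reasoning
  open ℤSolver.+-*-Solver

2[j⊖1+n]+1 : ∀ n j → + 2 ℤ.* (j ℤ.⊖ suc n) ℤ.+ + 1 ≡ (j ℕ.+ j) ℤ.⊖ suc (n ℕ.+ n)
2[j⊖1+n]+1 n j = begin
  + 2 ℤ.* (j ℤ.⊖ suc n) ℤ.+ + 1           ≡⟨ ≡.cong (λ k → + 2 ℤ.* k ℤ.+ + 1) (ℤₚ.m-n≡m⊖n j (suc n)) ⟨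
  + 2 ℤ.* (+ j ℤ.- + suc n) ℤ.+ + 1       ≡⟨ solve 2 (λ n j → con (+ 2) :* (j :- (con (+ 1) :+ n)) :+ con (+ 1) :=
                                               (j :+ j) :- (con (+ 1) :+ (n :+ n))) ≡.refl (+ n) (+ j) ⟩
  + (j ℕ.+ j) ℤ.- + suc (n ℕ.+ n)         ≡⟨ ℤₚ.m-n≡m⊖n (j ℕ.+ j) (suc (n ℕ.+ n)) ⟩
  (j ℕ.+ j) ℤ.⊖ suc (n ℕ.+ n)             ∎
  where
  open ≡.≡-Reasoning
  open ℤSolver.+-*-Solver

-- Finite sums, products and inverses in a commutative ring.

module QSeries {o ℓ} (R : CommutativeRing o ℓ) where
  open CommutativeRing R
  open import Algebra.Definitions.RawSemiring (Semiring.rawSemiring semiring) using (sum; product; _^_)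
  open import Algebra.Properties.CommutativeSemiring.Exp commutativeSemiring
    using (^-homo-*; ^-distrib-*; ^-congʳ)
  open import Algebra.Properties.Monoid.Sum +-monoid using (sum-cong-≋)
  open import Algebra.Properties.CommutativeMonoid.Sum +-commutativeMonoid using (∑-distrib-+)
  open import Algebra.Properties.Semiring.Sum semiring using (*-distribʳ-sum)
  import Algebra.Properties.Monoid.Sum *-monoid as Product
  open import Algebra.Properties.CommutativeMonoid.Sum *-commutativeMonoid
    using () renaming (∑-distrib-+ to product-distrib-*)
  open import Algebra.Properties.Ring ring using (-‿distribˡ-*; -‿distribʳ-*; -‿involutive; +-cancelʳ)
  open import Relation.Binary.Reasoning.Setoid setoid
  open import Algebra.Solver.Ring.NaturalCoefficients.Default commutativeSemiring

  Σ< Π< : ℕ → (ℕ → Carrier) → Carrier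
  Σ< n f = sum {n} (λ i → f (toℕ i))
  Π< n f = product {n} (λ i → f (toℕ i))

  Σ-cong : ∀ n {f g} → (∀ i → i ℕ.< n → f i ≈ g i) → Σ< n f ≈ Σ< n g
  Σ-cong n h = sum-cong-≋ {n} (λ i → h (toℕ i) (Finₚ.toℕ<n i))

  Σ-+ : ∀ n f g → Σ< n (λ i → f i + g i) ≈ Σ< n f + Σ< n g
  Σ-+ n f g = ∑-distrib-+ {n} (λ i → f (toℕ i)) (λ i → g (toℕ i))

  Σ-*ʳ : ∀ n f x → Σ< n f * x ≈ Σ< n (λ i → f i * x)
  Σ-*ʳ n f x = *-distribʳ-sum {n} x (λ i → f (toℕ i))

  Σ-snoc : ∀ n f → Σ< (suc n) f ≈ Σ< n f + f n
  Σ-snoc zero    f = +-comm (f 0) 0#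
  Σ-snoc (suc n) f = trans (+-congˡ (Σ-snoc n (λ i → f (suc i)))) (sym (+-assoc _ _ _))

  Π-cong : ∀ n {f g} → (∀ i → f i ≈ g i) → Π< n f ≈ Π< n g
  Π-cong n h = Product.sum-cong-≋ {n} (λ i → h (toℕ i))

  Π-* : ∀ n f g → Π< n (λ i → f i * g i) ≈ Π< n f * Π< n g
  Π-* n f g = product-distrib-* {n} (λ i → f (toℕ i)) (λ i → g (toℕ i))

  Π-const : ∀ n x → Π< n (λ _ → x) ≈ x ^ n
  Π-const n x = Product.sum-replicate n {x}

  Π-snoc : ∀ n f → Π< (suc n) f ≈ Π< n f * f n
  Π-snoc zero    f = *-comm (f 0) 1#
  Π-snoc (suc n) f = trans (*-congˡ (Π-snoc n (λ i → f (suc i)))) (sym (*-assoc _ _ _))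

  1-x+x≈1 : ∀ x → 1# - x + x ≈ 1#
  1-x+x≈1 x = trans (+-assoc _ _ _) (trans (+-congˡ (-‿inverseˡ x)) (+-identityʳ 1#))

  -- Quotients are represented by elements inverse to their denominators, so equalities between
  -- quotients are obtained through this uniqueness.
  inverse-unique : ∀ {x y y′} → x * y ≈ 1# → x * y′ ≈ 1# → y ≈ y′
  inverse-unique {x} {y} {y′} h h′ = begin
    y            ≈⟨ *-identityʳ y ⟨
    y * 1#       ≈⟨ *-congˡ h′ ⟨
    y * (x * y′) ≈⟨ solve 3 (λ x y y′ → y :* (x :* y′) := (x :* y) :* y′) refl x y y′ ⟩
    (x * y) * y′ ≈⟨ *-congʳ h ⟩
    1# * y′      ≈⟨ *-identityˡ y′ ⟩
    y′           ∎

  ^*^≈1 : ∀ {x y} → x * y ≈ 1# → ∀ n → x ^ n * y ^ n ≈ 1#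
  ^*^≈1 h zero    = *-identityˡ 1#
  ^*^≈1 {x} {y} h (suc n) = begin
    (x * x ^ n) * (y * y ^ n) ≈⟨ solve 4 (λ x a y b → (x :* a) :* (y :* b) := (x :* y) :* (a :* b)) refl x (x ^ n) y (y ^ n) ⟩
    (x * y) * (x ^ n * y ^ n) ≈⟨ *-cong h (^*^≈1 h n) ⟩
    1# * 1#                   ≈⟨ *-identityˡ 1# ⟩
    1#                        ∎

  poch : Carrier → Carrier → ℕ → Carrier
  poch a q n = Π< n (λ j → 1# - a * q ^ j)

  poch-neg : ∀ a q n → poch (- a) q n ≈ Π< n (λ j → 1# + a * q ^ j)
  poch-neg a q n = Π-cong n (λ j → +-congˡ
    (trans (-‿cong (sym (-‿distribˡ-* a (q ^ j)))) (-‿involutive (a * q ^ j))))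

  poch-suc : ∀ a q n → poch a q (suc n) ≈ poch a q n * (1# - a * q ^ n)
  poch-suc a q n = Π-snoc n (λ j → 1# - a * q ^ j)

  -- Gaussian binomial coefficients.

  module _ (q : Carrier) where

    -- The Gaussian binomial, generated by a q-Pascal rule to avoid division; `C-poch` recovers the
    -- quotient of Pochhammer symbols.
    [_C_] : ℕ → ℕ → Carrier
    [ _     C zero  ] = 1#
    [ zero  C suc j ] = 0#
    [ suc m C suc j ] = [ m C j ] + q ^ suc j * [ m C suc j ]

    -- An index above m takes the form `suc (m + k)` because the second Pascal term raises k in the
    -- induction on m.
    C-zero : ∀ m k → [ m C suc (m ℕ.+ k) ] ≈ 0#
    C-zero zero    k = refl
    C-zero (suc m) k = begin
      [ m C suc (m ℕ.+ k) ] + q ^ suc (suc m ℕ.+ k) * [ m C suc (suc (m ℕ.+ k)) ]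
        ≈⟨ +-cong (C-zero m k) (*-congˡ (trans
             (reflexive (≡.cong (λ i → [ m C suc i ]) (≡.sym (ℕₚ.+-suc m k)))) (C-zero m (suc k)))) ⟩
      0# + q ^ suc (suc m ℕ.+ k) * 0#
        ≈⟨ +-congˡ (zeroʳ _) ⟩
      0# + 0#
        ≈⟨ +-identityˡ 0# ⟩
      0# ∎

    C-suc-self : ∀ m → [ m C suc m ] ≈ 0#
    C-suc-self m = trans (reflexive (≡.cong (λ i → [ m C suc i ]) (≡.sym (ℕₚ.+-identityʳ m)))) (C-zero m 0)

    C-self : ∀ m → [ m C m ] ≈ 1#
    C-self zero    = refl
    C-self (suc m) = trans (+-cong (C-self m) (trans (*-congˡ (C-suc-self m)) (zeroʳ _))) (+-identityʳ 1#)

    -- The q-Pascal rule gives two terms, each a smaller instance times one leftover factor. With x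
    -- = q^(i+1) and y = q^(j+1) these factors combine as (1 - x) + x(1 - y) = 1 - xy.
    C-poch : ∀ i j → [ i ℕ.+ j C i ] * (poch q q j * poch q q i) ≈ poch q q (i ℕ.+ j)
    C-poch zero    j = trans (*-identityˡ _) (*-identityʳ _)
    C-poch (suc i) zero = begin
      [ suc i ℕ.+ 0 C suc i ] * (1# * poch q q (suc i))
        ≈⟨ *-cong (trans (reflexive (≡.cong (λ m → [ m C suc i ]) (ℕₚ.+-identityʳ (suc i)))) (C-self (suc i))) (*-identityˡ _) ⟩
      1# * poch q q (suc i)
        ≈⟨ *-identityˡ _ ⟩
      poch q q (suc i)
        ≈⟨ reflexive (≡.cong (poch q q) (≡.sym (ℕₚ.+-identityʳ (suc i)))) ⟩
      poch q q (suc i ℕ.+ 0) ∎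
    C-poch (suc i) (suc j) = begin
      (A + q ^ suc i * B) * (poch q q (suc j) * poch q q (suc i))
        ≈⟨ *-congˡ (*-cong (poch-suc q q j) (poch-suc q q i)) ⟩
      (A + x * B) * ((Pj * (1# - y)) * (Pi * (1# - x)))
        ≈⟨ solve 7 (λ A x B Pj ny Pi nx →
             (A :+ x :* B) :* ((Pj :* ny) :* (Pi :* nx)) :=
             (A :* ((Pj :* ny) :* Pi)) :* nx :+ x :* ((B :* (Pj :* (Pi :* nx))) :* ny))
             refl A x B Pj (1# - y) Pi (1# - x) ⟩
      (A * ((Pj * (1# - y)) * Pi)) * (1# - x) + x * ((B * (Pj * (Pi * (1# - x)))) * (1# - y))
        ≈⟨ +-cong (*-congʳ (trans (*-congˡ (*-congʳ (sym (poch-suc q q j)))) (C-poch i (suc j))))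
                  (*-congˡ (*-congʳ (trans (*-congˡ (*-congˡ (sym (poch-suc q q i)))) B-poch))) ⟩
      P * (1# - x) + x * (P * (1# - y))
        ≈⟨ solve 4 (λ P nx x ny → P :* nx :+ x :* (P :* ny) := P :* (nx :+ x :* ny))
             refl P (1# - x) x (1# - y) ⟩
      P * ((1# - x) + x * (1# - y))
        ≈⟨ *-congˡ telescope ⟩
      P * (1# - q * q ^ (i ℕ.+ suc j))
        ≈⟨ poch-suc q q (i ℕ.+ suc j) ⟨
      poch q q (suc i ℕ.+ suc j) ∎
      where
      A = [ i ℕ.+ suc j C i ]
      B = [ i ℕ.+ suc j C suc i ]
      x = q ^ suc i
      y = q ^ suc j
      Pi = poch q q i
      Pj = poch q q j
      P = poch q q (i ℕ.+ suc j)
      B-poch : B * (Pj * poch q q (suc i)) ≈ P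
      B-poch = ≡.subst (λ m → [ m C suc i ] * (Pj * poch q q (suc i)) ≈ poch q q m)
        (≡.sym (ℕₚ.+-suc i j)) (C-poch (suc i) j)
      telescope : (1# - x) + x * (1# - y) ≈ 1# - q * q ^ (i ℕ.+ suc j)
      telescope = begin
        (1# - x) + x * (1# - y)            ≈⟨ +-identityʳ _ ⟨
        (1# - x) + x * (1# - y) + 0#       ≈⟨ +-congˡ (-‿inverseʳ (x * y)) ⟨
        (1# - x) + x * (1# - y) + (x * y - x * y)
          ≈⟨ solve 5 (λ nx x ny y nxy → nx :+ x :* ny :+ (x :* y :+ nxy) := nx :+ x :* (ny :+ y) :+ nxy)
               refl (1# - x) x (1# - y) y (- (x * y)) ⟩
        (1# - x) + x * ((1# - y) + y) - x * y
          ≈⟨ +-congʳ (+-congˡ (trans (*-congˡ (1-x+x≈1 y)) (*-identityʳ x))) ⟩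
        (1# - x) + x - x * y               ≈⟨ +-cong (1-x+x≈1 x) (-‿cong (sym (^-homo-* q (suc i) (suc j)))) ⟩
        1# - q * q ^ (i ℕ.+ suc j)         ∎

    -- Weighted sums of Gaussian binomials and the finite Jacobi triple product.

    gaussianSum : ℕ → (ℕ → Carrier) → Carrier → Carrier
    gaussianSum m a w = Σ< (suc m) (λ j → [ m C j ] * (a j * w ^ j))

    -- The last term on the right contains [m, m+1] = 0. Running the tail one place too far gives
    -- both halves of a Pascal split the same range.
    gaussianSum-head : ∀ m a w →
      gaussianSum m a w ≈ a 0 + Σ< (suc m) (λ j → [ m C suc j ] * (a (suc j) * w ^ suc j))
    gaussianSum-head m a w = begin
      gaussianSum m a w         ≈⟨ +-identityʳ _ ⟨
      gaussianSum m a w + 0#    ≈⟨ +-congˡ (trans (*-congʳ (C-suc-self m)) (zeroˡ _)) ⟨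
      gaussianSum m a w + t (suc m) ≈⟨ Σ-snoc (suc m) t ⟨
      t 0 + Σ< (suc m) (λ j → t (suc j)) ≈⟨ +-congʳ (trans (*-identityˡ _) (*-identityʳ _)) ⟩
      a 0 + Σ< (suc m) (λ j → t (suc j)) ∎
      where t = λ j → [ m C j ] * (a j * w ^ j)

    -- The q-Pascal rule splits each term in two. The first halves sum to w times the old sum; in
    -- the second, the last hypothesis trades q^(j+1) a_j for r a_(j+1), which gives r times the old
    -- sum.
    gaussianSum-* : ∀ m a a′ r w → (∀ j → a′ (suc j) ≈ a j) → a′ 0 ≈ r * a 0 →
      (∀ j → r * a (suc j) ≈ q ^ suc j * a j) →
      gaussianSum (suc m) a′ w ≈ gaussianSum m a w * (w + r)
    gaussianSum-* m a a′ r w h h₀ hr = begin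
      1# * (a′ 0 * 1#) + Σ< (suc m) (λ j → ([ m C j ] + q ^ suc j * [ m C suc j ]) * (a′ (suc j) * w ^ suc j))
        ≈⟨ +-cong (trans (*-identityˡ _) (trans (*-identityʳ _) (trans h₀ (*-comm r (a 0)))))
             (Σ-cong (suc m) (λ j _ → split j)) ⟩
      a 0 * r + Σ< (suc m) (λ j → t j * w + t⁺ j * r)
        ≈⟨ +-congˡ (trans (Σ-+ (suc m) (λ j → t j * w) (λ j → t⁺ j * r)) (sym (+-cong (Σ-*ʳ (suc m) t w) (Σ-*ʳ (suc m) t⁺ r)))) ⟩
      a 0 * r + (S * w + S⁺ * r)
        ≈⟨ solve 5 (λ a r S w S⁺ → a :* r :+ (S :* w :+ S⁺ :* r) := S :* w :+ (a :+ S⁺) :* r) refl (a 0) r S w S⁺ ⟩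
      S * w + (a 0 + S⁺) * r
        ≈⟨ +-congˡ (*-congʳ (gaussianSum-head m a w)) ⟨
      S * w + S * r
        ≈⟨ distribˡ S w r ⟨
      S * (w + r) ∎
      where
      t t⁺ : ℕ → Carrier
      t  j = [ m C j ] * (a j * w ^ j)
      t⁺ j = [ m C suc j ] * (a (suc j) * w ^ suc j)
      S = Σ< (suc m) t
      S⁺ = Σ< (suc m) t⁺
      split : ∀ j → [ suc m C suc j ] * (a′ (suc j) * w ^ suc j) ≈ t j * w + t⁺ j * r
      split j = begin
        (G + x * G⁺) * (a′ (suc j) * (w * W)) ≈⟨ *-congˡ (*-congʳ (h j)) ⟩
        (G + x * G⁺) * (a j * (w * W))
          ≈⟨ solve 6 (λ G x G⁺ a w W → (G :+ x :* G⁺) :* (a :* (w :* W)) :=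
               (G :* (a :* W)) :* w :+ G⁺ :* ((x :* a) :* (w :* W))) refl G x G⁺ (a j) w W ⟩
        (G * (a j * W)) * w + G⁺ * ((x * a j) * (w * W)) ≈⟨ +-congˡ (*-congˡ (*-congʳ (hr j))) ⟨
        (G * (a j * W)) * w + G⁺ * ((r * a (suc j)) * (w * W))
          ≈⟨ +-congˡ (solve 4 (λ g r a W → g :* ((r :* a) :* W) := (g :* (a :* W)) :* r) refl G⁺ r (a (suc j)) (w * W)) ⟩
        t j * w + t⁺ j * r ∎
        where
        G = [ m C j ]
        G⁺ = [ m C suc j ]
        x = q ^ suc j
        W = w ^ j

    -- Each unit of shift in the weights `e n` enlarges the row by one and contributes one linear
    -- factor.
    gaussianSum-Π : ∀ (e : ℕ → ℕ → Carrier) (r : ℕ → Carrier) w →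
      (∀ n j → e (suc n) (suc j) ≈ e n j) → (∀ n → e (suc n) 0 ≈ r n * e n 0) →
      (∀ n j → r n * e n (suc j) ≈ q ^ suc j * e n j) →
      ∀ n m → gaussianSum (n ℕ.+ m) (e n) w ≈ gaussianSum m (e 0) w * Π< n (λ i → w + r i)
    gaussianSum-Π e r w h h₀ hr zero    m = sym (*-identityʳ _)
    gaussianSum-Π e r w h h₀ hr (suc n) m = begin
      gaussianSum (suc n ℕ.+ m) (e (suc n)) w
        ≈⟨ gaussianSum-* (n ℕ.+ m) (e n) (e (suc n)) (r n) w (h n) (h₀ n) (hr n) ⟩
      gaussianSum (n ℕ.+ m) (e n) w * (w + r n)
        ≈⟨ *-congʳ (gaussianSum-Π e r w h h₀ hr n m) ⟩
      gaussianSum m (e 0) w * Π< n (λ i → w + r i) * (w + r n)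
        ≈⟨ trans (*-assoc _ _ _) (*-congˡ (sym (Π-snoc n (λ i → w + r i)))) ⟩
      gaussianSum m (e 0) w * Π< (suc n) (λ i → w + r i) ∎

    -- The finite q-binomial theorem. Since C(j+1,2) = j + C(j,2), the powers q^j left by the Pascal
    -- split are absorbed into w, so the row m + 1 at w is (1 + w) times the row m at wq.
    q-binomial : ∀ m w → gaussianSum m (λ j → q ^ shiftedBinom₂ 0 j) w ≈ Π< m (λ i → 1# + w * q ^ i)
    q-binomial zero    w = trans (+-identityʳ _) (trans (*-identityˡ _) (*-identityˡ _))
    q-binomial (suc m) w = begin
      1# * (1# * 1#) + Σ< (suc m) (λ j → [ suc m C suc j ] * (b (suc j) * w ^ suc j))
        ≈⟨ +-cong (trans (*-identityˡ _) (*-identityˡ _)) (Σ-cong (suc m) (λ j _ → split j)) ⟩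
      1# + Σ< (suc m) (λ j → t j * w + t⁺ j)
        ≈⟨ +-congˡ (trans (Σ-+ (suc m) (λ j → t j * w) t⁺) (+-congʳ (sym (Σ-*ʳ (suc m) t w)))) ⟩
      1# + (S * w + S⁺)
        ≈⟨ solve 3 (λ S w S⁺ → con 1 :+ (S :* w :+ S⁺) := (con 1 :+ S⁺) :+ w :* S) refl S w S⁺ ⟩
      (1# + S⁺) + w * S
        ≈⟨ +-congʳ (gaussianSum-head m b (w * q)) ⟨
      S + w * S
        ≈⟨ solve 2 (λ S w → S :+ w :* S := (con 1 :+ w :* con 1) :* S) refl S w ⟩
      (1# + w * 1#) * S
        ≈⟨ *-congˡ (trans (q-binomial m (w * q)) (Π-cong m (λ i → +-congˡ (*-assoc w q (q ^ i))))) ⟩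
      (1# + w * 1#) * Π< m (λ i → 1# + w * q ^ suc i) ∎
      where
      b t t⁺ : ℕ → Carrier
      b j = q ^ shiftedBinom₂ 0 j
      t j = [ m C j ] * (b j * (w * q) ^ j)
      t⁺ j = [ m C suc j ] * (b (suc j) * (w * q) ^ suc j)
      S = Σ< (suc m) t
      S⁺ = Σ< (suc m) t⁺
      split : ∀ j → [ suc m C suc j ] * (b (suc j) * w ^ suc j) ≈ t j * w + t⁺ j
      split j = begin
        (G + q * Y * G⁺) * (B * (w * W))
          ≈⟨ solve 7 (λ G q Y G⁺ B w W → (G :+ q :* Y :* G⁺) :* (B :* (w :* W)) :=
               G :* (B :* (w :* W)) :+ G⁺ :* (B :* ((w :* q) :* (W :* Y)))) refl G q Y G⁺ B w W ⟩
        G * (B * (w * W)) + G⁺ * (B * ((w * q) * (W * Y)))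
          ≈⟨ +-congʳ (*-congˡ (*-congʳ (^-homo-* q j (shiftedBinom₂ 0 j)))) ⟩
        G * ((Y * b j) * (w * W)) + G⁺ * (B * ((w * q) * (W * Y)))
          ≈⟨ +-congʳ (solve 5 (λ G Y b w W → G :* ((Y :* b) :* (w :* W)) := (G :* (b :* (W :* Y))) :* w) refl G Y (b j) w W) ⟩
        (G * (b j * (W * Y))) * w + G⁺ * (B * ((w * q) * (W * Y)))
          ≈⟨ +-cong (*-congʳ (*-congˡ (*-congˡ (^-distrib-* w q j))))
                    (*-congˡ (*-congˡ (*-congˡ (^-distrib-* w q j)))) ⟨
        t j * w + t⁺ j ∎
        where
        G = [ m C j ]
        G⁺ = [ m C suc j ]
        Y = q ^ j
        W = w ^ j
        B = b (suc j)

    ^-exchange : ∀ i j k l → i ℕ.+ j ≡ k ℕ.+ l → q ^ i * q ^ j ≈ q ^ k * q ^ l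
    ^-exchange i j k l h =
      trans (sym (^-homo-* q i j)) (trans (^-congʳ q h) (^-homo-* q k l))

    -- The finite Jacobi triple product: shift 0 is the q-binomial theorem, and the recurrence for
    -- C(j-n,2) forces the ratio r n = q^(n+1).
    tripleProduct : ∀ n m w → gaussianSum (n ℕ.+ m) (λ j → q ^ shiftedBinom₂ n j) w ≈
      Π< m (λ i → 1# + w * q ^ i) * Π< n (λ i → w + q ^ suc i)
    tripleProduct n m w = trans
      (gaussianSum-Π (λ n j → q ^ shiftedBinom₂ n j) (λ n → q ^ suc n) w
        (λ _ _ → refl) (λ n → ^-homo-* q (suc n) (shiftedBinom₂ n 0))
        (λ n j → ^-exchange (suc n) _ (suc j) _ (≡.cong suc (shiftedBinom₂-suc n j))) n m)
      (*-congʳ (q-binomial m w))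

    -- The same product for shift n - 1, including shift -1 at n = 0, where the extra q^j turns w
    -- into wq in the q-binomial theorem. The ratio is now r n = q^n.
    tripleProduct-suc : ∀ n m w → gaussianSum (n ℕ.+ m) (λ j → q ^ shiftedBinom₂ n (suc j)) w ≈
      Π< m (λ i → 1# + w * q ^ suc i) * Π< n (λ i → w + q ^ i)
    tripleProduct-suc n m w = trans
      (gaussianSum-Π (λ n j → q ^ shiftedBinom₂ n (suc j)) (λ n → q ^ n) w
        (λ _ _ → refl)
        (λ n → trans (^-congʳ q (≡.sym (shiftedBinom₂-suc n 0))) (^-homo-* q n (shiftedBinom₂ n 1)))
        (λ n j → ^-exchange n _ (suc j) _ (shiftedBinom₂-suc n (suc j))) n m)
      (*-congʳ (begin
        gaussianSum m (λ j → q ^ shiftedBinom₂ 0 (suc j)) w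
          ≈⟨ Σ-cong (suc m) (λ j _ → *-congˡ {[ m C j ]} (shift j)) ⟩
        gaussianSum m (λ j → q ^ shiftedBinom₂ 0 j) (w * q)
          ≈⟨ q-binomial m (w * q) ⟩
        Π< m (λ i → 1# + (w * q) * q ^ i)
          ≈⟨ Π-cong m (λ i → +-congˡ (*-assoc w q (q ^ i))) ⟩
        Π< m (λ i → 1# + w * q ^ suc i) ∎))
      where
      shift : ∀ j → q ^ shiftedBinom₂ 0 (suc j) * w ^ j ≈ q ^ shiftedBinom₂ 0 j * (w * q) ^ j
      shift j = begin
        q ^ (j ℕ.+ shiftedBinom₂ 0 j) * w ^ j
          ≈⟨ *-congʳ (^-homo-* q j (shiftedBinom₂ 0 j)) ⟩
        (q ^ j * q ^ shiftedBinom₂ 0 j) * w ^ j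
          ≈⟨ solve 3 (λ y b x → (y :* b) :* x := b :* (x :* y)) refl (q ^ j) (q ^ shiftedBinom₂ 0 j) (w ^ j) ⟩
        q ^ shiftedBinom₂ 0 j * (w ^ j * q ^ j)
          ≈⟨ *-congˡ (^-distrib-* w q j) ⟨
        q ^ shiftedBinom₂ 0 j * (w * q) ^ j ∎

    -- The difference of the two products is F (w - 1) (1 - q²ⁿ⁺¹), written without subtraction.
    product-difference : ∀ n w →
      let f = λ i → w + q ^ i
          g = λ i → 1# + w * q ^ i
          F = Π< n f * Π< n g
          Q = q * q ^ (n ℕ.+ n)
      in Π< n g * Π< (suc n) (λ i → f (suc i)) + F * (1# + w * Q) ≈
         Π< (suc n) (λ i → g (suc i)) * Π< n f + F * (w + Q)
    product-difference zero w =
      solve 2 (λ w q → con 1 :* ((w :+ q :* con 1) :* con 1) :+ con 1 :* con 1 :* (con 1 :+ w :* (q :* con 1)) :=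
        (con 1 :+ w :* (q :* con 1)) :* con 1 :* con 1 :+ con 1 :* con 1 :* (w :+ q :* con 1)) refl w q
    -- For n ≥ 1 the factors at 0, n and n + 1 can be split off. All products then share f′ g′, and
    -- a polynomial identity in w, q and x = q^n remains.
    product-difference n@(suc m) w = begin
      (g 0 * g′) * Π< (suc n) (λ i → f (suc i)) + F * (1# + w * Q)
        ≈⟨ +-cong (*-congˡ (snoc₂ f)) (*-congˡ (+-congˡ (*-congˡ Q≈))) ⟩
      (g 0 * g′) * ((f′ * f n) * f (suc n)) + F * (1# + w * (q * (x * x)))
        ≈⟨ solve 5 (λ f′ g′ w q x →
             ((con 1 :+ w :* con 1) :* g′) :* ((f′ :* (w :+ x)) :* (w :+ q :* x))
               :+ (((w :+ con 1) :* f′) :* ((con 1 :+ w :* con 1) :* g′)) :* (con 1 :+ w :* (q :* (x :* x)))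
             := ((g′ :* (con 1 :+ w :* x)) :* (con 1 :+ w :* (q :* x))) :* ((w :+ con 1) :* f′)
               :+ (((w :+ con 1) :* f′) :* ((con 1 :+ w :* con 1) :* g′)) :* (w :+ q :* (x :* x)))
             refl f′ g′ w q x ⟩
      ((g′ * g n) * g (suc n)) * (f 0 * f′) + F * (w + q * (x * x))
        ≈⟨ +-cong (*-congʳ (snoc₂ g)) (*-congˡ (+-congˡ Q≈)) ⟨
      Π< (suc n) (λ i → g (suc i)) * (f 0 * f′) + F * (w + Q) ∎
      where
      f g : ℕ → Carrier
      f i = w + q ^ i
      g i = 1# + w * q ^ i
      f′ = Π< m (λ i → f (suc i))
      g′ = Π< m (λ i → g (suc i))
      F = (f 0 * f′) * (g 0 * g′)
      x = q ^ n
      Q = q * q ^ (n ℕ.+ n)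
      Q≈ : Q ≈ q * (x * x)
      Q≈ = *-congˡ (^-homo-* q n n)
      snoc₂ : ∀ h → Π< (suc n) (λ i → h (suc i)) ≈ (Π< m (λ i → h (suc i)) * h n) * h (suc n)
      snoc₂ h = trans (Π-snoc n (λ i → h (suc i))) (*-congʳ (Π-snoc m (λ i → h (suc i))))

    -- The Bailey sum in a commutative ring, with p = 1/q, u = 1/z, s = 1/(1 - z).

    module BaileySum {p z u s : Carrier} (qp≈1 : q * p ≈ 1#) (zu≈1 : z * u ≈ 1#) (hs : (1# - z) * s ≈ 1#)
      (inv : ℕ → ℕ → Carrier) (inv-inverse : ∀ i j → (poch q q i * poch q q j) * inv i j ≈ 1#)
      (n : ℕ) where

      private
        M = suc (n ℕ.+ n)
        Q = q * q ^ (n ℕ.+ n)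
        -- As (q)_0 = 1, this is 1/(q)_(2n+1).
        y = inv M 0
        PP = poch (- z) q n * poch (- u) q n
        -- With k = j - n - 1 these are q^C(k,2) and q^C(k+2,2).
        c c′ : ℕ → Carrier
        c j = q ^ shiftedBinom₂ (suc n) j
        c′ j = q ^ shiftedBinom₂ n (suc j)
        f g : ℕ → Carrier
        f i = u + q ^ i
        g i = 1# + u * q ^ i
        F = Π< n f * Π< n g
        T : ℕ → Carrier
        T j = [ M C j ] * ((c j - c′ j) * u ^ j)

      -- By `C-poch`, both sides are inverse to the same product of Pochhammer symbols.
      inv-C : ∀ j → j ℕ.≤ M → inv (M ℕ.∸ j) j ≈ [ M C j ] * y
      inv-C j j≤M = inverse-unique (inv-inverse (M ℕ.∸ j) j) (begin
        (poch q q (M ℕ.∸ j) * poch q q j) * ([ M C j ] * y)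
          ≈⟨ solve 3 (λ P G y → P :* (G :* y) := ((G :* P) :* con 1) :* y) refl _ [ M C j ] y ⟩
        (([ M C j ] * (poch q q (M ℕ.∸ j) * poch q q j)) * 1#) * y
          ≈⟨ *-congʳ (*-congʳ (≡.subst (λ m → [ m C j ] * (poch q q (M ℕ.∸ j) * poch q q j) ≈ poch q q m)
               (ℕₚ.m+[n∸m]≡n j≤M) (C-poch j (M ℕ.∸ j)))) ⟩
        (poch q q M * 1#) * y
          ≈⟨ inv-inverse M 0 ⟩
        1# ∎)

      -- The product of powers of q and p is q^(2k+1), and `shiftedBinom₂-double` shows that it
      -- carries `c j` to `c′ j`.
      c-diff : ∀ j → c j * (1# - q ^ (j ℕ.+ j) * p ^ M) ≈ c j - c′ j
      c-diff j = trans (distribˡ (c j) 1# _) (+-cong (*-identityʳ (c j))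
        (trans (sym (-‿distribʳ-* (c j) _)) (-‿cong (begin
          c j * (q ^ (j ℕ.+ j) * p ^ M) ≈⟨ *-assoc _ _ _ ⟨
          c j * q ^ (j ℕ.+ j) * p ^ M   ≈⟨ *-congʳ (^-exchange (shiftedBinom₂ (suc n) j) _ (shiftedBinom₂ n (suc j)) M
                                             (shiftedBinom₂-double n j)) ⟩
          c′ j * q ^ M * p ^ M          ≈⟨ *-assoc _ _ _ ⟩
          c′ j * (q ^ M * p ^ M)        ≈⟨ *-congˡ (^*^≈1 qp≈1 M) ⟩
          c′ j * 1#                     ≈⟨ *-identityʳ _ ⟩
          c′ j                          ∎))))

      -- In other words the sum is F (u - 1)(1 - Q). Adding the second triple product `EB` to both
      -- sides makes `product-difference` applicable, and it cancels at the end.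
      ΣT : Σ< (suc M) T + F * (1# + u * Q) ≈ F * (u + Q)
      ΣT = +-cancelʳ EB _ _ (begin
        (Σ< (suc M) T + F * (1# + u * Q)) + EB
          ≈⟨ solve 3 (λ t x b → (t :+ x) :+ b := (t :+ b) :+ x) refl _ _ EB ⟩
        (Σ< (suc M) T + EB) + F * (1# + u * Q)
          ≈⟨ +-congʳ (trans (sym (Σ-+ (suc M) T (λ j → [ M C j ] * (c′ j * u ^ j)))) (Σ-cong (suc M) (λ j _ → T+B j))) ⟩
        gaussianSum M c u + F * (1# + u * Q)
          ≈⟨ +-congʳ (tripleProduct (suc n) n u) ⟩
        Π< n g * Π< (suc n) (λ i → f (suc i)) + F * (1# + u * Q)
          ≈⟨ product-difference n u ⟩
        Π< (suc n) (λ i → g (suc i)) * Π< n f + F * (u + Q)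
          ≈⟨ +-congʳ (≡.subst (λ m → gaussianSum m c′ u ≈ Π< (suc n) (λ i → g (suc i)) * Π< n f)
               (ℕₚ.+-suc n n) (tripleProduct-suc n (suc n) u)) ⟨
        EB + F * (u + Q)
          ≈⟨ +-comm _ _ ⟩
        F * (u + Q) + EB ∎)
        where
        EB = gaussianSum M c′ u
        T+B : ∀ j → T j + [ M C j ] * (c′ j * u ^ j) ≈ [ M C j ] * (c j * u ^ j)
        T+B j = begin
          [ M C j ] * ((c j - c′ j) * u ^ j) + [ M C j ] * (c′ j * u ^ j)
            ≈⟨ solve 5 (λ G a b d x → G :* ((a :+ b) :* x) :+ G :* (d :* x) := G :* ((a :+ (b :+ d)) :* x))
                 refl [ M C j ] (c j) (- c′ j) (c′ j) (u ^ j) ⟩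
          [ M C j ] * ((c j + (- c′ j + c′ j)) * u ^ j)
            ≈⟨ *-congˡ (*-congʳ (trans (+-congˡ (-‿inverseˡ (c′ j))) (+-identityʳ (c j)))) ⟩
          [ M C j ] * (c j * u ^ j) ∎

      -- Each of the n copies of z enters one factor of the first product: z(u + q^i) = 1 + zq^i.
      z^nF≈PP : z ^ n * F ≈ PP
      z^nF≈PP = begin
        z ^ n * (Π< n f * Π< n g) ≈⟨ *-assoc _ _ _ ⟨
        z ^ n * Π< n f * Π< n g   ≈⟨ *-cong (trans (*-congʳ (sym (Π-const n z))) (sym (Π-* n (λ _ → z) f))) refl ⟩
        Π< n (λ i → z * f i) * Π< n g
          ≈⟨ *-cong (trans (Π-cong n (λ i → trans (distribˡ z u (q ^ i)) (+-congʳ zu≈1))) (sym (poch-neg z q n)))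
                    (sym (poch-neg u q n)) ⟩
        PP ∎

      -- The n copies of z turn F into `PP`, and the remaining one turns u - 1 into 1 - z. In
      -- additive form: z(1 + uQ) = z + Q and z(u + Q) = 1 + zQ = (1 - z)(1 - Q) + (z + Q).
      z^ΣT : z ^ suc n * Σ< (suc M) T ≈ PP * ((1# - z) * (1# - Q))
      z^ΣT = +-cancelʳ (PP * (z + Q)) _ _ (begin
        (z * z ^ n) * S + PP * (z + Q)
          ≈⟨ +-congˡ (*-congˡ (+-congˡ (trans (*-congʳ zu≈1) (*-identityˡ Q)))) ⟨
        (z * z ^ n) * S + PP * (z + (z * u) * Q)
          ≈⟨ +-congˡ (*-congʳ z^nF≈PP) ⟨
        (z * z ^ n) * S + (z ^ n * F) * (z + (z * u) * Q)
          ≈⟨ solve 6 (λ z Z S F u Q → (z :* Z) :* S :+ (Z :* F) :* (z :+ (z :* u) :* Q) :=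
               (z :* Z) :* (S :+ F :* (con 1 :+ u :* Q))) refl z (z ^ n) S F u Q ⟩
        (z * z ^ n) * (S + F * (1# + u * Q))
          ≈⟨ *-congˡ ΣT ⟩
        (z * z ^ n) * (F * (u + Q))
          ≈⟨ solve 5 (λ z Z F u Q → (z :* Z) :* (F :* (u :+ Q)) := (Z :* F) :* (z :* u :+ z :* Q)) refl z (z ^ n) F u Q ⟩
        (z ^ n * F) * (z * u + z * Q)
          ≈⟨ *-cong z^nF≈PP (trans (+-congʳ zu≈1) expand) ⟩
        PP * ((1# - z) * (1# - Q) + (z + Q))
          ≈⟨ distribˡ PP _ _ ⟩
        PP * ((1# - z) * (1# - Q)) + PP * (z + Q) ∎)
        where
        S = Σ< (suc M) T
        a = 1# - z
        b = 1# - Q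
        expand : 1# + z * Q ≈ a * b + (z + Q)
        expand = begin
          1# + z * Q ≈⟨ +-congʳ (trans (sym (*-identityˡ 1#)) (sym (*-cong (1-x+x≈1 z) (1-x+x≈1 Q)))) ⟩
          (a + z) * (b + Q) + z * Q
            ≈⟨ solve 4 (λ a b z Q → (a :+ z) :* (b :+ Q) :+ z :* Q := a :* b :+ (z :* (b :+ Q) :+ Q :* (a :+ z))) refl a b z Q ⟩
          a * b + (z * (b + Q) + Q * (a + z))
            ≈⟨ +-congˡ (+-cong (trans (*-congˡ (1-x+x≈1 Q)) (*-identityʳ z)) (trans (*-congˡ (1-x+x≈1 z)) (*-identityʳ Q))) ⟩
          a * b + (z + Q) ∎

      -- Here v = 1/(q)_(2n) is rewritten as (1 - Q)/(q)_(2n+1), whose numerator is the factor 1 - Q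
      -- of `z^ΣT`.
      bailey : ∀ {v} → poch q q (n ℕ.+ n) * v ≈ 1# →
        PP * v ≈ Σ< (suc M) (λ j →
          ((z ^ suc n * u ^ j) * c j * (1# - q ^ (j ℕ.+ j) * p ^ M)) * s * inv (M ℕ.∸ j) j)
      bailey {v} hv = begin
        PP * v ≈⟨ *-congˡ (inverse-unique hv v≈) ⟩
        -- Inserting (1 - z) s = 1 provides the other factor of `z^ΣT` and leaves s as the
        -- denominator of α.
        PP * ((1# - Q) * y) ≈⟨ *-congˡ (trans (*-congʳ hs) (*-identityˡ _)) ⟨
        PP * (((1# - z) * s) * ((1# - Q) * y))
          ≈⟨ solve 5 (λ P a s b y → P :* ((a :* s) :* (b :* y)) := (P :* (a :* b)) :* (s :* y)) refl PP (1# - z) s (1# - Q) y ⟩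
        (PP * ((1# - z) * (1# - Q))) * (s * y) ≈⟨ *-congʳ z^ΣT ⟨
        (z ^ suc n * Σ< (suc M) T) * (s * y)
          ≈⟨ solve 3 (λ Z S k → (Z :* S) :* k := S :* (Z :* k)) refl (z ^ suc n) _ (s * y) ⟩
        Σ< (suc M) T * (z ^ suc n * (s * y)) ≈⟨ Σ-*ʳ (suc M) T _ ⟩
        Σ< (suc M) (λ j → T j * (z ^ suc n * (s * y))) ≈⟨ Σ-cong (suc M) (λ j j< → term j (ℕₚ.≤-pred j<)) ⟩
        Σ< (suc M) (λ j → ((z ^ suc n * u ^ j) * c j * (1# - q ^ (j ℕ.+ j) * p ^ M)) * s * inv (M ℕ.∸ j) j) ∎
        where
        v≈ : poch q q (n ℕ.+ n) * ((1# - Q) * y) ≈ 1#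
        v≈ = begin
          poch q q (n ℕ.+ n) * ((1# - Q) * y)
            ≈⟨ solve 3 (λ P b y → P :* (b :* y) := ((P :* b) :* con 1) :* y) refl (poch q q (n ℕ.+ n)) (1# - Q) y ⟩
          ((poch q q (n ℕ.+ n) * (1# - Q)) * 1#) * y
            ≈⟨ *-congʳ (*-congʳ (poch-suc q q (n ℕ.+ n))) ⟨
          (poch q q M * 1#) * y ≈⟨ inv-inverse M 0 ⟩
          1# ∎
        term : ∀ j → j ℕ.≤ M → T j * (z ^ suc n * (s * y)) ≈
          ((z ^ suc n * u ^ j) * c j * (1# - q ^ (j ℕ.+ j) * p ^ M)) * s * inv (M ℕ.∸ j) j
        term j j≤M = begin
          ([ M C j ] * ((c j - c′ j) * u ^ j)) * (z ^ suc n * (s * y))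
            ≈⟨ *-congʳ (*-congˡ (*-congʳ (c-diff j))) ⟨
          ([ M C j ] * ((c j * d) * u ^ j)) * (z ^ suc n * (s * y))
            ≈⟨ solve 7 (λ G c d U Z s y → (G :* ((c :* d) :* U)) :* (Z :* (s :* y)) :=
                 (((Z :* U) :* c) :* d) :* s :* (G :* y)) refl [ M C j ] (c j) d (u ^ j) (z ^ suc n) s y ⟩
          ((z ^ suc n * u ^ j) * c j * d) * s * ([ M C j ] * y)
            ≈⟨ *-congˡ (inv-C j j≤M) ⟨
          ((z ^ suc n * u ^ j) * c j * d) * s * inv (M ℕ.∸ j) j ∎
          where d = 1# - q ^ (j ℕ.+ j) * p ^ M

-- Passage to integer indices and integer powers.

open import Defs using (binom₂)

-- The dividend is an exact double, so integer division by 2 loses nothing.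
binom₂-⊖ : ∀ n j → binom₂ (j ℤ.⊖ n) ≡ + shiftedBinom₂ n j
binom₂-⊖ n j = ≡.trans (≡.cong (ℤ._/ + 2) (shiftedBinom₂-ℤ n j))
  (≡.trans (ℤ.div-pos-is-/ℕ (+ (shiftedBinom₂ n j ℕ.* 2)) 2)
    (≡.cong +_ (ℕ.m*n/n≡m (shiftedBinom₂ n j) 2)))

-- The ring operations are separate parameters, so that at ℂ all types mention the operations of ℂ
-- themselves: comparing them with projections of a ring record would unfold the Cauchy proofs.
module BaileyPair {o ℓ} {A : Set o} {_≈_ : Rel A ℓ} {_+_ _*_ _-_ : Op₂ A} { -_ : Op₁ A} {0# 1# : A}
  (isCommutativeRing : IsCommutativeRing _≈_ _+_ _*_ -_ 0# 1#)
  (minus : ∀ x y → x - y ≡ x + (- y)) where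

  R : CommutativeRing o ℓ
  R = record { isCommutativeRing = isCommutativeRing }

  open RawSemiringDefinitions (Semiring.rawSemiring (CommutativeRing.semiring R))
    using (sum; product) renaming (_^_ to rawPower)
  open CommutativeRing R
    using (sym; trans; reflexive; setoid; *-cong; *-congˡ; *-congʳ; *-identityˡ; *-identityʳ; +-congˡ; -‿cong)
  open import Algebra.Properties.CommutativeSemigroup
    (CommutativeRing.*-commutativeSemigroup R) using (interchange)
  open import Relation.Binary.Reasoning.Setoid setoid
  open QSeries R using (Σ<; Σ-cong; Π-cong; poch; inverse-unique; module BaileySum)
  open BaileySum using (bailey)

  module WithPower {_^_ : A → ℕ → A} (^≡ : ∀ x m → (x ^ m) ≡ rawPower x m) where

    ^-zero : ∀ x → (x ^ 0) ≡ 1#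
    ^-zero x = ^≡ x 0

    ^-suc : ∀ x m → (x ^ suc m) ≡ (x * (x ^ m))
    ^-suc x m = ≡.trans (^≡ x (suc m)) (≡.cong (x *_) (≡.sym (^≡ x m)))

    ^-cong : ∀ {x y} m → x ≈ y → (x ^ m) ≈ (y ^ m)
    ^-cong {x} {y} zero    h = reflexive (≡.trans (^-zero x) (≡.sym (^-zero y)))
    ^-cong {x} {y} (suc m) h = trans (reflexive (^-suc x m))
      (trans (*-cong h (^-cong m h)) (reflexive (≡.sym (^-suc y m))))

    module _ {x y : A} (xy≈1 : (x * y) ≈ 1#) {pow : ℤ → A}
      (pow-+ : ∀ m → pow (+ m) ≡ (x ^ m)) (pow-- : ∀ m → pow -[1+ m ] ≡ (y ^ suc m)) where

      -- Common powers of x and y cancel in pairs through xy = 1.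
      pow-⊖ : ∀ m n → pow (m ℤ.⊖ n) ≈ ((x ^ m) * (y ^ n))
      pow-⊖ m       zero    = trans (reflexive (pow-+ m)) (sym (trans (*-congˡ (reflexive (^-zero y))) (*-identityʳ _)))
      pow-⊖ zero    (suc n) = trans (reflexive (pow-- n)) (sym (trans (*-congʳ (reflexive (^-zero x))) (*-identityˡ _)))
      pow-⊖ (suc m) (suc n) = begin
        pow (suc m ℤ.⊖ suc n)               ≡⟨ ≡.cong pow (ℤₚ.[1+m]⊖[1+n]≡m⊖n m n) ⟩
        pow (m ℤ.⊖ n)                       ≈⟨ pow-⊖ m n ⟩
        (x ^ m) * (y ^ n)                   ≈⟨ *-identityˡ _ ⟨
        1# * ((x ^ m) * (y ^ n))            ≈⟨ *-congʳ xy≈1 ⟨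
        (x * y) * ((x ^ m) * (y ^ n))       ≈⟨ interchange x y (x ^ m) (y ^ n) ⟩
        (x * (x ^ m)) * (y * (y ^ n))       ≡⟨ ≡.cong₂ _*_ (^-suc x m) (^-suc y n) ⟨
        (x ^ suc m) * (y ^ suc n)           ∎

    -- Negative powers are built from an inverse of x that depends on a proof of non-vanishing; this
    -- makes the choice of proof irrelevant.
    pow-unique : ∀ {x y y′ : A} {pow pow′ : ℤ → A} → (x * y) ≈ 1# → (x * y′) ≈ 1# →
      (∀ m → pow (+ m) ≡ (x ^ m)) → (∀ m → pow -[1+ m ] ≡ (y ^ suc m)) →
      (∀ m → pow′ (+ m) ≡ (x ^ m)) → (∀ m → pow′ -[1+ m ] ≡ (y′ ^ suc m)) →
      ∀ k → pow k ≈ pow′ k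
    pow-unique h h′ p+ p- p′+ p′- (+ m)    = reflexive (≡.trans (p+ m) (≡.sym (p′+ m)))
    pow-unique h h′ p+ p- p′+ p′- -[1+ m ] = trans (reflexive (p- m))
      (trans (^-cong (suc m) (inverse-unique h h′)) (reflexive (≡.sym (p′- m))))

    IsPochhammer : (A → A → ℕ → A) → Set o
    IsPochhammer P = ∀ a q n → P a q n ≡ product {n} (λ j → 1# - (a * (q ^ toℕ j)))

    -- The ingredients `β`, `Y`, `F`, `f`, `a`, `b`, `c` and `S` are variables tied to the ring data
    -- by equations, so whichever non-vanishing proofs occur inside them do not matter.
    baileyPair : ∀ {q p z u s : A} {qpow zpow : ℤ → A} {P : A → A → ℕ → A}
      {inv₁ : ℕ → A} {inv₂ : ℕ → ℕ → A} →
      (q * p) ≈ 1# → (z * u) ≈ 1# → ((1# - z) * s) ≈ 1# →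
      (∀ m → qpow (+ m) ≡ (q ^ m)) → (∀ m → qpow -[1+ m ] ≡ (p ^ suc m)) →
      (∀ m → zpow (+ m) ≡ (z ^ m)) → (∀ m → zpow -[1+ m ] ≡ (u ^ suc m)) →
      IsPochhammer P →
      (∀ m → (P q q m * inv₁ m) ≈ 1#) → (∀ i j → ((P q q i * P q q j) * inv₂ i j) ≈ 1#) →
      ∀ n {β : A} {F : Fin n → A} {Y : A} {S : (ℤ → A) → A} {f a b c : ℤ → A} →
      β ≈ ((P (- z) q n * Y) * inv₁ (2 ℕ.* n)) →
      Y ≡ product F →
      (∀ i → F i ≈ (1# - ((- (1# * u)) * (q ^ toℕ i)))) →
      (∀ k → f k ≈ ((((a k * b k) * (1# - c k)) * s) *
        inv₂ ℤ.∣ + n ℤ.- k ∣ ℤ.∣ + n ℤ.+ k ℤ.+ + 1 ∣)) →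
      (∀ k → a k ≈ zpow (ℤ.- k)) → (∀ k → b k ≈ qpow (binom₂ k)) →
      (∀ k → c k ≈ qpow (+ 2 ℤ.* k ℤ.+ + 1)) →
      (∀ f → S f ≡ sum {(n ℕ.+ 1) ℕ.+ suc n} (λ j → f (-[1+ n ] ℤ.+ + toℕ j))) →
      β ≈ S f
    baileyPair {q} {p} {z} {u} {s} {qpow} {zpow} {P} {inv₁} {inv₂}
      qp≈1 zu≈1 hs qpow-+ qpow-- zpow-+ zpow-- P≡ inverse₁ inverse₂
      n {β} {F} {Y} {S} {f} {a} {b} {c} β≈ Y≡ F≈ f≈ a≈ b≈ c≈ S≡ = begin
      β
        ≈⟨ β≈ ⟩
      (P (- z) q n * Y) * v
        ≈⟨ *-congʳ (*-cong (P≈ (- z) q n) (trans (reflexive Y≡) (Product.sum-cong-≋ {n} Y≈))) ⟩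
      (poch (- z) q n * poch (- u) q n) * v
        ≈⟨ bailey q qp≈1 zu≈1 (trans (*-congʳ (reflexive (≡.sym (minus 1# z)))) hs) inv₂
             (λ i j → trans (*-congʳ (*-cong (sym (P≈ q q i)) (sym (P≈ q q j)))) (inverse₂ i j)) n
             (trans (*-congʳ (trans (sym (P≈ q q (n ℕ.+ n))) (reflexive (≡.cong (P q q) 2n≡)))) (inverse₁ (2 ℕ.* n))) ⟩
      Σ< (suc M) (λ j → ((((rawPower z (suc n) * rawPower u j) * rawPower q (shiftedBinom₂ (suc n) j)) *
          (1# + (- (rawPower q (j ℕ.+ j) * rawPower p M)))) * s) * inv₂ (M ℕ.∸ j) j)
        ≈⟨ Σ-cong (suc M) (λ j j< → trans (*-cong (*-congʳ (sym (α-⊖ j))) (inv-⊖ j (ℕₚ.≤-pred j<)))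
             (sym (f≈ (j ℤ.⊖ suc n)))) ⟩
      Σ< (suc M) (λ j → f (j ℤ.⊖ suc n))
        ≡⟨ ≡.cong (λ m → Σ< m (λ j → f (j ℤ.⊖ suc n))) range ⟩
      Σ< ((n ℕ.+ 1) ℕ.+ suc n) (λ j → f (j ℤ.⊖ suc n))
        -- The index `-[1+ n ] + + j` of the sum computes to `j ⊖ suc n`.
        ≡⟨ S≡ f ⟨
      S f ∎
      where
      module Product = MonoidSum (CommutativeRing.*-monoid R)
      M = suc (n ℕ.+ n)
      v = inv₁ (2 ℕ.* n)

      factor≈ : ∀ a q j → (1# - (a * (q ^ j))) ≈ (1# + (- (a * rawPower q j)))
      factor≈ a q j = trans (reflexive (minus 1# _)) (+-congˡ (-‿cong (*-congˡ (reflexive (^≡ q j)))))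

      P≈ : ∀ a q n → P a q n ≈ poch a q n
      P≈ a q n = trans (reflexive (P≡ a q n)) (Π-cong n (factor≈ a q))

      -- The factor `1#` is the numerator of 1/z, read as 1 times the inverse of z.
      Y≈ : ∀ i → F i ≈ (1# + (- ((- u) * rawPower q (toℕ i))))
      Y≈ i = trans (F≈ i) (trans (factor≈ (- (1# * u)) q (toℕ i))
        (+-congˡ (-‿cong (*-congʳ {rawPower q (toℕ i)} (-‿cong (*-identityˡ u))))))

      2n≡ : n ℕ.+ n ≡ 2 ℕ.* n
      2n≡ = ≡.cong (n ℕ.+_) (≡.sym (ℕₚ.+-identityʳ n))

      -- The right-hand side is the form to which hi + 1 - lo computes for the limits -n-1 and n.
      range : suc M ≡ (n ℕ.+ 1) ℕ.+ suc n
      range = ≡.trans (≡.cong suc (≡.sym (ℕₚ.+-suc n n))) (≡.cong (ℕ._+ suc n) (ℕₚ.+-comm 1 n))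

      raw* : ∀ x m y n → ((x ^ m) * (y ^ n)) ≈ (rawPower x m * rawPower y n)
      raw* x m y n = reflexive (≡.cong₂ _*_ (^≡ x m) (^≡ y n))

      α-⊖ : ∀ j → let k = j ℤ.⊖ suc n in
        ((a k * b k) * (1# - c k)) ≈
        (((rawPower z (suc n) * rawPower u j) * rawPower q (shiftedBinom₂ (suc n) j)) *
          (1# + (- (rawPower q (j ℕ.+ j) * rawPower p M))))
      α-⊖ j = *-cong
        (*-cong
          (trans (a≈ k) (trans (reflexive (≡.cong zpow (≡.sym (ℤₚ.⊖-swap (suc n) j))))
            (trans (pow-⊖ zu≈1 {zpow} zpow-+ zpow-- (suc n) j) (raw* z (suc n) u j))))
          (trans (b≈ k) (reflexive (≡.trans (≡.cong qpow (binom₂-⊖ (suc n) j))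
            (≡.trans (qpow-+ (shiftedBinom₂ (suc n) j)) (^≡ q (shiftedBinom₂ (suc n) j)))))))
        (trans (reflexive (minus 1# _)) (+-congˡ (-‿cong
          (trans (c≈ k) (trans (reflexive (≡.cong qpow (2[j⊖1+n]+1 n j)))
            (trans (pow-⊖ qp≈1 {qpow} qpow-+ qpow-- (j ℕ.+ j) M) (raw* q (j ℕ.+ j) p M)))))))
        where k = j ℤ.⊖ suc n

      inv-⊖ : ∀ j → j ℕ.≤ M → inv₂ (M ℕ.∸ j) j ≈
        inv₂ ℤ.∣ + n ℤ.- (j ℤ.⊖ suc n) ∣ ℤ.∣ + n ℤ.+ (j ℤ.⊖ suc n) ℤ.+ + 1 ∣
      inv-⊖ j j≤M = reflexive (≡.sym (≡.cong₂ inv₂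
        (≡.cong ℤ.∣_∣ (n-[j⊖1+n] n j j≤M)) (≡.cong ℤ.∣_∣ (n+[j⊖1+n]+1 n j))))

-- The instance at the complex numbers.

open import Defs

module ℂ-BaileyPair = BaileyPair {_≈_ = _≈_} {_+_} {_*_} {_-_} { -_} {0ℂ} {1ℂ}
  (CommutativeRing.isCommutativeRing ℂ-commutativeRing) (λ _ _ → ≡.refl)

open ℂ-BaileyPair.WithPower {_^_} (λ _ _ → ≡.refl)

^[]-unique : ∀ w (w≠0 w≠0′ : NonZero w) k → w ^[ w≠0 ] k ≈ w ^[ w≠0′ ] k
^[]-unique w w≠0 w≠0′ = pow-unique
  {w} {w ⁻¹[ w≠0 ]} {w ⁻¹[ w≠0′ ]} {w ^[ w≠0 ]_} {w ^[ w≠0′ ]_}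
  (⁻¹-inverseʳ w w≠0) (⁻¹-inverseʳ w w≠0′)
  (λ _ → ≡.refl) (λ _ → ≡.refl) (λ _ → ≡.refl) (λ _ → ≡.refl)

-- The underscores are the non-vanishing proofs local to alpha and beta, which have no names here.
-- pointwiseℂ compares the rational approximations only, and these do not depend on such proofs.
lemma3p5 : (q z : ℂ)
    (0<∣q∣ : 0ᵣ <ᵣ ∣ q ∣) (∣q∣<1 : ∣ q ∣ <ᵣ 1ᵣ)
    (0<∣z∣ : 0ᵣ <ᵣ ∣ z ∣) (∣z∣<1 : ∣ z ∣ <ᵣ 1ᵣ) →
    IsAsymmetricBilateralBaileyPair q (poch-q-nonZero q ∣q∣<1)
    (alpha q z 0<∣q∣ 0<∣z∣ ∣z∣<1)
    (beta q z ∣q∣<1 0<∣z∣)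
lemma3p5 q z 0<∣q∣ ∣q∣<1 0<∣z∣ ∣z∣<1 n = baileyPair
  {q} {q ⁻¹[ q≠0 ]} {z} {z ⁻¹[ z≠0 ]} {(1ℂ - z) ⁻¹[ 1-z≠0 ]} {q ^[ q≠0 ]_} {z ^[ z≠0 ]_} {poch}
  {λ m → poch q q m ⁻¹[ poch-q-nonZero q ∣q∣<1 m ]}
  {λ i j → (poch q q i * poch q q j) ⁻¹[ nonZero-* (poch q q i) (poch q q j)
             (poch-q-nonZero q ∣q∣<1 i) (poch-q-nonZero q ∣q∣<1 j) ]}
  (⁻¹-inverseʳ q q≠0) (⁻¹-inverseʳ z z≠0) (⁻¹-inverseʳ (1ℂ - z) 1-z≠0)
  (λ _ → ≡.refl) (λ _ → ≡.refl) (λ _ → ≡.refl) (λ _ → ≡.refl) (λ _ _ _ → ≡.refl)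
  (λ m → ⁻¹-inverseʳ (poch q q m) (poch-q-nonZero q ∣q∣<1 m))
  (λ i j → ⁻¹-inverseʳ (poch q q i * poch q q j) (nonZero-* (poch q q i) (poch q q j)
             (poch-q-nonZero q ∣q∣<1 i) (poch-q-nonZero q ∣q∣<1 j)))
  n {β = beta q z ∣q∣<1 0<∣z∣ n} {F = _} {Y = product {n} _} {S = ∑ -[1+ n ] (+ n)}
  {f = λ k →
    let i = ℤ.∣ + n ℤ.- k ∣
        j = ℤ.∣ + n ℤ.+ k ℤ.+ + 1 ∣
    in alpha q z 0<∣q∣ 0<∣z∣ ∣z∣<1 k ÷ (poch q q i * poch q q j) [ nonZero-* (poch q q i) (poch q q j)
         (poch-q-nonZero q ∣q∣<1 i) (poch-q-nonZero q ∣q∣<1 j) ]}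
  {a = λ k → z ^[ _ ] (ℤ.- k)} {b = λ k → q ^[ _ ] binom₂ k}
  {c = λ k → q ^[ _ ] (+ 2 ℤ.* k ℤ.+ + 1)}
  (pointwiseℂ (λ _ → ≡.refl) (λ _ → ≡.refl)) ≡.refl
  (λ _ → pointwiseℂ (λ _ → ≡.refl) (λ _ → ≡.refl))
  (λ _ → pointwiseℂ (λ _ → ≡.refl) (λ _ → ≡.refl))
  (λ k → ^[]-unique z _ z≠0 (ℤ.- k))
  (λ k → ^[]-unique q _ q≠0 (binom₂ k))
  (λ k → ^[]-unique q _ q≠0 (+ 2 ℤ.* k ℤ.+ + 1))
  (λ _ → ≡.refl)
  where
  q≠0 = 0<∣z∣⇒nonZero q 0<∣q∣
  z≠0 = 0<∣z∣⇒nonZero z 0<∣z∣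
  1-z≠0 = nonZero-1- z (∣z∣<1⇒normSq<1 z ∣z∣<1)
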